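{- There is a polynomial-time algorithm that, given a $k$-terminal digraph $G$ (not necessarily acyclic) and a pair-set $P\subseteq K\times K$, outputs a reachability-preserving minor $H$ of $G$ with respect to $P$ having $O(|P|^{2})$ non-terminal vertices.
   Context: A $k$-terminal digraph is a digraph $G=(V,E)$ with terminal set $K\subset V$, $|K|=k$. A minor of a digraph is obtained by vertex deletions, edge deletions and edge contractions (contracting $(u,v)$ identifies $u$ and $v$, discarding loops), never deleting terminals nor identifying two terminals. For a pair-set $P\subseteq K\times K$, a reachability-preserving minor of $G$ with respect to $P$ is a minor $H$ of $G$ with $K\subseteq V(H)$ such that for every $(s,t)\in P$, $t$ is reachable from $s$ in $H$ iff $t$ is reachable from $s$ in $G$. "Polynomial time" is polynomial in $|V(G)|$. -}

module Defs where

open import Data.Bool using (Bool; true; false; T; if_then_else_; _∧_)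
open import Data.Bool.Properties using (T?)
open import Data.Nat using (ℕ; zero; suc; _+_; _∸_; _^_; _*_; _≤_; _<?_; _≡ᵇ_)
open import Data.Fin using (Fin; toℕ; fromℕ<)
open import Data.Fin.Properties using (_≟_)
open import Data.Fin.Subset using (Subset; _∈_; _∉_; _⊆_; ⊤; _-_; _─_; ∣_∣)
open import Data.List using (List; length; filter; allFin; cartesianProduct)
open import Data.Product using (∃-syntax; _×_; _,_)
open import Data.Sum using (_⊎_)
open import Data.Vec using (lookup)
open import Function using (_⇔_)
open import Relation.Binary.Construct.Closure.ReflexiveTransitive using (Star)
open import Relation.Binary.PropositionalEquality using (_≡_; _≢_)
open import Relation.Nullary using (¬_; yes; no; does)

PairSet : ℕ → Set
PairSet n = Fin n → Fin n → Bool

pairs : ∀ {n} → PairSet n → List (Fin n × Fin n)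
pairs {n} P = filter (λ { (s , t) → T? (P s t) }) (cartesianProduct (allFin n) (allFin n))

size : ∀ {n} → PairSet n → ℕ
size P = length (pairs P)

-- Vertices are named by elements of Fin n, but only those in V are present, so
-- that the minors of a digraph on Fin n can keep the names of its vertices.
record Digraph (n : ℕ) : Set where
  field
    V   : Subset n
    E   : PairSet n
    E⊆V : ∀ u v → T (E u v) → u ∈ V × v ∈ V

open Digraph public

Reachable : ∀ {n} → Digraph n → Fin n → Fin n → Set
Reachable G = Star (λ u v → T (E G u v))

record TerminalDigraph (n k : ℕ) : Set where
  field
    graph     : Digraph n
    V≡⊤       : V graph ≡ ⊤
    K         : Subset n
    ∣K∣≡k     : ∣ K ∣ ≡ k

open TerminalDigraph public

rename : ∀ {n} → Fin n → Fin n → Fin n → Fin n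
rename gone kept x = if does (x ≟ gone) then kept else x

-- Contracting an edge (u , v) yields one vertex, named by either of its two
-- members. Terminals have to keep their names, so the name that disappears must
-- be a nonterminal; this is possible exactly when u and v are not both terminals.
data MinorStep {n : ℕ} (K : Subset n) (G H : Digraph n) : Set where
  deleteVertex : ∀ v → v ∈ V G → v ∉ K →
    V H ≡ V G - v →
    (∀ x y → T (E H x y) ⇔ (T (E G x y) × x ≢ v × y ≢ v)) →
    MinorStep K G H
  deleteEdge : ∀ u v → T (E G u v) →
    V H ≡ V G →
    (∀ x y → T (E H x y) ⇔ (T (E G x y) × ¬ (x ≡ u × y ≡ v))) →
    MinorStep K G H
  contractEdge : ∀ kept gone → T (E G kept gone) ⊎ T (E G gone kept) →
    kept ≢ gone → gone ∉ K →
    V H ≡ V G - gone →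
    (∀ x y → T (E H x y) ⇔
      (x ≢ y × ∃[ x′ ] ∃[ y′ ]
        (T (E G x′ y′) × rename gone kept x′ ≡ x × rename gone kept y′ ≡ y))) →
    MinorStep K G H

Minor : ∀ {n} → Subset n → Digraph n → Digraph n → Set
Minor K = Star (MinorStep K)

PairsOf : ∀ {n} → Subset n → PairSet n → Set
PairsOf K P = ∀ s t → T (P s t) → s ∈ K × t ∈ K

record ReachabilityPreservingMinor {n k : ℕ} (G : TerminalDigraph n k)
         (P : PairSet n) (H : Digraph n) : Set where
  field
    isMinor   : Minor (K G) (graph G) H
    terminals : K G ⊆ V H
    preserves : ∀ s t → T (P s t) → Reachable H s t ⇔ Reachable (graph G) s t

nonterminals : ∀ {n k} → TerminalDigraph n k → Digraph n → ℕ
nonterminals G H = ∣ V H ─ K G ∣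

-- The model of computation: a structured random-access machine. Its memory
-- consists of two-dimensional arrays of natural numbers, numbered by ℕ, and
-- σ a i j is the content of cell (i , j) of array a. Arithmetic is addition and
-- truncated subtraction only: with no multiplication, values have O(t) bits after
-- t steps, so unit-cost time agrees with Turing machine time up to a polynomial.

Store : Set
Store = ℕ → ℕ → ℕ → ℕ

data Expr : Set where
  lit     : ℕ → Expr
  _[_,_]  : ℕ → Expr → Expr → Expr
  _⊕_ _⊖_ : Expr → Expr → Expr

eval : Store → Expr → ℕ
eval σ (lit m)       = m
eval σ (a [ e , f ]) = σ a (eval σ e) (eval σ f)
eval σ (e ⊕ f)       = eval σ e + eval σ f
eval σ (e ⊖ f)       = eval σ e ∸ eval σ f

write : Store → ℕ → ℕ → ℕ → ℕ → Store
write σ a i j m b i′ j′ =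
  if (b ≡ᵇ a) ∧ (i′ ≡ᵇ i) ∧ (j′ ≡ᵇ j) then m else σ b i′ j′

data Program : Set where
  skip    : Program
  set     : ℕ → Expr → Expr → Expr → Program
  _⨾_     : Program → Program → Program
  ifte    : Expr → Program → Program → Program
  while   : Expr → Program → Program

infixr 20 _⨾_

-- ⟨ p , σ ⟩⇓[ t ] σ′ : started in σ, p halts in σ′ after t assignments and tests.
-- Expressions have a size fixed by the program, so their evaluation costs O(1).
-- Nonzero counts as true.
data ⟨_,_⟩⇓[_]_ : Program → Store → ℕ → Store → Set where
  skip⇓ : ∀ {σ} → ⟨ skip , σ ⟩⇓[ 1 ] σ
  set⇓ : ∀ {σ a e f g} →
    ⟨ set a e f g , σ ⟩⇓[ 1 ] write σ a (eval σ e) (eval σ f) (eval σ g)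
  seq⇓ : ∀ {p q σ σ′ σ″ s t} →
    ⟨ p , σ ⟩⇓[ s ] σ′ → ⟨ q , σ′ ⟩⇓[ t ] σ″ → ⟨ p ⨾ q , σ ⟩⇓[ s + t ] σ″
  then⇓ : ∀ {e p q σ σ′ t} → eval σ e ≢ 0 →
    ⟨ p , σ ⟩⇓[ t ] σ′ → ⟨ ifte e p q , σ ⟩⇓[ suc t ] σ′
  else⇓ : ∀ {e p q σ σ′ t} → eval σ e ≡ 0 →
    ⟨ q , σ ⟩⇓[ t ] σ′ → ⟨ ifte e p q , σ ⟩⇓[ suc t ] σ′
  stop⇓ : ∀ {e p σ} → eval σ e ≡ 0 → ⟨ while e p , σ ⟩⇓[ 1 ] σ
  loop⇓ : ∀ {e p σ σ′ σ″ s t} → eval σ e ≢ 0 →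
    ⟨ p , σ ⟩⇓[ s ] σ′ → ⟨ while e p , σ′ ⟩⇓[ t ] σ″ →
    ⟨ while e p , σ ⟩⇓[ suc (s + t) ] σ″

bit : Bool → ℕ
bit b = if b then 1 else 0

pad : ∀ {n} → (Fin n → ℕ) → ℕ → ℕ
pad {n} f i with i <? n
... | yes i<n = f (fromℕ< i<n)
... | no  _   = 0

matrix : ∀ {n} → PairSet n → ℕ → ℕ → ℕ
matrix R i j = pad (λ u → pad (λ v → bit (R u v)) j) i

-- Array 0 holds n in cell (0 , 0), array 1 the terminals in column 0, arrays 2
-- and 3 the 0/1 matrices of the edges and of P. All other cells are 0.
input : ∀ {n k} → TerminalDigraph n k → PairSet n → Store
input {n} G P 0 0 0 = n
input     G P 1 i 0 = pad (λ v → bit (lookup (K G) v)) i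
input     G P 2 i j = matrix (E (graph G)) i j
input     G P 3 i j = matrix P i j
input     G P _ _ _ = 0

-- Array 4 holds the vertices in column 0 and array 5 the edges.
record Outputs {n : ℕ} (σ : Store) (H : Digraph n) : Set where
  field
    vertices : ∀ v → σ 4 (toℕ v) 0 ≡ bit (lookup (V H) v)
    edges    : ∀ u v → σ 5 (toℕ u) (toℕ v) ≡ bit (E H u v)

-- p computes, within time b n on inputs with n vertices, some H related to
-- the input (G , P) by the specification Spec.
SolvesInTime : Program → (ℕ → ℕ) →
  (∀ {n k} → TerminalDigraph n k → PairSet n → Digraph n → Set) → Set
SolvesInTime p b Spec =
  ∀ {n k} (G : TerminalDigraph n k) (P : PairSet n) → PairsOf (K G) P →
  ∃[ t ] ∃[ σ ] ∃[ H ]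
    (⟨ p , input G P ⟩⇓[ t ] σ × t ≤ b n × Outputs σ H × Spec G P H)

{-# OPTIONS --safe #-}

-- Deletions and contractions are tried greedily, and kept when they leave the
-- reachability on P unchanged. Contracting an edge u → v lets v reach u and nothing
-- else, which is harmless as soon as all in-neighbours of v reach u. So when no step
-- is possible any more, a nonterminal v lies on no cycle and has two in-neighbours.
-- Both edges into v are unavoidable for some pair of P, as they could be deleted
-- otherwise, and these two pairs determine v: if v′ had the same pairs and came after
-- v, the first pair could go to v, change to a walk of the second pair as far as v′,
-- and so avoid its own edge into v′. This leaves at most |P|² nonterminals.
--
-- A minimal minor is reached after n rounds. A round tries to delete every edge and
-- then to contract every edge into, and to delete, every nonterminal; if the second
-- half does nothing then the graph is minimal, because an edge that is unavoidable
-- stays so when other edges are deleted, and otherwise a nonterminal has gone.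

module Submission where

open import Defs
open import Data.Bool using (Bool; true; false; T; _∧_; _∨_; not; _xor_)
open import Data.Bool.Properties using (T?; T-≡; T-∧; T-∨; T-not-≡; ∨-conicalˡ; ∨-conicalʳ)
open import Data.Fin using (Fin; zero; suc; toℕ; fromℕ<; combine)
open import Data.Fin.Properties
  using (_≟_; any?; all?; ¬∀⟶∃¬; suc-injective; injective⇒≤; combine-injective;
         toℕ<n; fromℕ<-toℕ; toℕ-fromℕ<; toℕ-injective)
open import Data.Fin.Subset using (Subset; _∈_; _∉_; _⊆_; _-_; _─_; ∣_∣; ⊤; inside; outside; ⁅_⁆)
open import Data.Fin.Subset.Properties
  using (∈⊤; ∣p∣≤n; p─⊥≡p; p─q⊆p; p─q─r≡p─r─q; x∈p∧x∉q⇒x∈p─q; x∈p∧x≢y⇒x∈p-y; x∈p⇒∣p-x∣<∣p∣)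
open import Data.List using ([]; _∷_) renaming (lookup to at-index)
open import Data.List.Membership.Propositional as List using ()
open import Data.List.Membership.Propositional.Properties
  using (∈-filter⁺; ∈-cartesianProduct⁺; ∈-allFin)
open import Data.List.Relation.Unary.All using (All; []; _∷_)
open import Data.List.Relation.Unary.Any using (index)
open import Data.List.Relation.Unary.Any.Properties using (lookup-index)
open import Data.Nat
  using (ℕ; zero; suc; _+_; _*_; _^_; _∸_; _≤_; _<_; _≡ᵇ_; _<?_; z≤n; s≤s)
open import Data.Nat.Properties as ℕ using (module ≤-Reasoning)
open import Data.Product as Prod using (∃₂; ∃-syntax; _×_; _,_; proj₁; proj₂)
open import Data.Sum as Sum using (_⊎_; inj₁; inj₂)
open import Data.Unit using (tt)
open import Data.Vec using (lookup; _∷_; here; there)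
open import Data.Vec.Properties using ([]=⇒lookup; lookup⇒[]=)
open import Function using (_⇔_; mk⇔; Equivalence; _∘_; id)
open import Function.Properties.Equivalence using () renaming (sym to ⇔-sym; trans to ⇔-trans)
open import Relation.Binary.Construct.Closure.ReflexiveTransitive as Star
  using (Star; ε; _◅_; _◅◅_)
open import Relation.Binary.PropositionalEquality hiding ([_])
open import Relation.Nullary using (¬_; Dec; yes; no; does; ¬?; _×-dec_; contradiction)
import Relation.Nullary.Decidable as Dec
open import Relation.Nullary.Decidable using (_→-dec_)

open Equivalence using (to; from)

private variable
  n : ℕ

T-does : ∀ {A : Set} (A? : Dec A) → T (does A?) ⇔ A
T-does (yes a) = mk⇔ (λ _ → a) _
T-does (no ¬a) = mk⇔ (λ ()) ¬a

-- Walks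

Walk : PairSet n → Fin n → Fin n → Set
Walk E = Star (λ u v → T (E u v))

-- The edge sets after the three kinds of step are Boolean formulas because the program evaluates
-- these very formulas entry by entry.
withoutEdge : PairSet n → Fin n → Fin n → PairSet n
withoutEdge E u v x y = E x y ∧ not (does (x ≟ u) ∧ does (y ≟ v))

withoutVertex : PairSet n → Fin n → PairSet n
withoutVertex E v x y = E x y ∧ (not (does (x ≟ v)) ∧ not (does (y ≟ v)))

contraction : PairSet n → Fin n → Fin n → PairSet n
contraction E kept gone x y =
  (not (does (x ≟ y)) ∧ (not (does (x ≟ gone)) ∧ not (does (y ≟ gone)))) ∧
  (E x y ∨ ((does (x ≟ kept) ∧ E gone y) ∨ (does (y ≟ kept) ∧ E x gone)))

rename-≢ : ∀ {gone kept x : Fin n} → x ≢ gone → rename gone kept x ≡ x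
rename-≢ {gone = gone} {x = x} x≢g with x ≟ gone
... | yes x≡g = contradiction x≡g x≢g
... | no _ = refl

module _ (E : PairSet n) where

  withoutEdge-⇔ : ∀ u v x y →
    T (withoutEdge E u v x y) ⇔ (T (E x y) × ¬ (x ≡ u × y ≡ v))
  withoutEdge-⇔ u v x y = mk⇔
    (λ h → let e , k = to T-∧ h in e , to (T-does (¬? (x ≟ u ×-dec y ≟ v))) k)
    (λ (e , k) → from T-∧ (e , from (T-does (¬? (x ≟ u ×-dec y ≟ v))) k))

  withoutVertex-⇔ : ∀ v x y →
    T (withoutVertex E v x y) ⇔ (T (E x y) × x ≢ v × y ≢ v)
  withoutVertex-⇔ v x y = mk⇔
    (λ h → let e , k = to T-∧ h in e , to (T-does (¬? (x ≟ v) ×-dec ¬? (y ≟ v))) k)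
    (λ (e , k) → from T-∧ (e , from (T-does (¬? (x ≟ v) ×-dec ¬? (y ≟ v))) k))

  contraction-cases : ∀ kept gone x y → T (contraction E kept gone x y) ⇔
    ((x ≢ y × x ≢ gone × y ≢ gone) ×
     (T (E x y) ⊎ (x ≡ kept × T (E gone y)) ⊎ (y ≡ kept × T (E x gone))))
  contraction-cases kept gone x y = mk⇔
    (λ h → let g , e = to T-∧ h in to (T-does guard) g ,
      Sum.map₂ (Sum.map (Prod.map₁ (to (T-does (x ≟ kept))) ∘ to T-∧)
                        (Prod.map₁ (to (T-does (y ≟ kept))) ∘ to T-∧) ∘ to T-∨) (to T-∨ e))
    (λ (g , e) → from T-∧ (from (T-does guard) g , from T-∨
      (Sum.map₂ (from T-∨ ∘ Sum.map (from T-∧ ∘ Prod.map₁ (from (T-does (x ≟ kept))))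
                                    (from T-∧ ∘ Prod.map₁ (from (T-does (y ≟ kept))))) e)))
    where
    guard = ¬? (x ≟ y) ×-dec (¬? (x ≟ gone) ×-dec ¬? (y ≟ gone))

  contraction-⇔ : ∀ {kept gone} → kept ≢ gone → ∀ x y →
    T (contraction E kept gone x y) ⇔
      (x ≢ y × ∃[ x′ ] ∃[ y′ ]
        (T (E x′ y′) × rename gone kept x′ ≡ x × rename gone kept y′ ≡ y))
  contraction-⇔ {kept} {gone} k≢g x y = mk⇔ (⇒ ∘ to cases) (from cases ∘ ⇐)
    where
    cases = contraction-cases kept gone x y

    rename-gone : rename gone kept gone ≡ kept
    rename-gone with gone ≟ gone
    ... | yes _ = refl
    ... | no g≢g = contradiction refl g≢g

    ⇒ : _
    ⇒ ((x≢y , x≢g , y≢g) , inj₁ e) =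
      x≢y , x , y , e , rename-≢ x≢g , rename-≢ y≢g
    ⇒ ((x≢y , x≢g , y≢g) , inj₂ (inj₁ (x≡k , e))) =
      x≢y , gone , y , e , trans rename-gone (sym x≡k) , rename-≢ y≢g
    ⇒ ((x≢y , x≢g , y≢g) , inj₂ (inj₂ (y≡k , e))) =
      x≢y , x , gone , e , rename-≢ x≢g , trans rename-gone (sym y≡k)

    ⇐ : _
    ⇐ (x≢y , x′ , y′ , e , refl , refl) with x′ ≟ gone | y′ ≟ gone
    ... | yes refl | yes refl = contradiction refl x≢y
    ... | yes refl | no y≢g = (x≢y , k≢g , y≢g) , inj₂ (inj₁ (refl , e))
    ... | no x≢g | yes refl = (x≢y , x≢g , k≢g) , inj₂ (inj₂ (refl , e))
    ... | no x≢g | no y≢g = (x≢y , x≢g , y≢g) , inj₁ e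

  -- The walk is scanned edge by edge and cut where it first takes `(u , v)`. Every rerouting
  -- argument below splits on this dichotomy.
  avoidEdge : ∀ u v {s t} → Walk E s t →
    Walk (withoutEdge E u v) s t ⊎ (Walk E s u × Walk E v t)
  avoidEdge u v ε = inj₁ ε
  avoidEdge u v (_◅_ {s} {y} e w) with s ≟ u ×-dec y ≟ v
  ... | yes (refl , refl) = inj₂ (ε , w)
  ... | no ≢uv with avoidEdge u v w
  ...   | inj₁ w′ = inj₁ (from (withoutEdge-⇔ u v s y) (e , ≢uv) ◅ w′)
  ...   | inj₂ (w₁ , w₂) = inj₂ (e ◅ w₁ , w₂)

  avoidLoop : ∀ v {s t} → Walk E s t → Walk (withoutEdge E v v) s t
  avoidLoop v ε = ε
  avoidLoop v (_◅_ {s} {y} e w) with s ≟ v ×-dec y ≟ v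
  ... | yes (refl , refl) = avoidLoop v w
  ... | no ≢vv = from (withoutEdge-⇔ v v s y) (e , ≢vv) ◅ avoidLoop v w

  -- A vertex that no edge enters can only be the first vertex of a walk.
  avoidVertex : ∀ {v} → (∀ x → ¬ T (E x v)) → ∀ {s t} → s ≢ v →
    Walk E s t → Walk (withoutVertex E v) s t
  avoidVertex sourceless s≢v ε = ε
  avoidVertex {v} sourceless {s} s≢v (_◅_ {_} {y} e w) =
    from (withoutVertex-⇔ v s y) (e , s≢v , y≢v) ◅ avoidVertex sourceless y≢v w
    where
    y≢v : y ≢ v
    y≢v refl = sourceless s e

  contract-walk : ∀ {kept gone} → kept ≢ gone → ∀ {s t} → Walk E s t →
    Walk (contraction E kept gone) (rename gone kept s) (rename gone kept t)
  contract-walk k≢g ε = ε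
  contract-walk {kept} {gone} k≢g (_◅_ {s} {y} e w)
    with rename gone kept s ≟ rename gone kept y
  ... | yes eq rewrite eq = contract-walk k≢g w
  ... | no ≢ = from (contraction-⇔ k≢g _ _) (≢ , s , y , e , refl , refl) ◅ contract-walk k≢g w

  -- An edge that left `gone` is preceded by the contracted edge. The only edges giving new
  -- reachability are those that entered `gone` and now enter `kept`; the hypothesis replaces each
  -- of them by a walk.
  uncontract-walk : ∀ {kept gone} → T (E kept gone) → (∀ x → T (E x gone) → Walk E x kept) →
    ∀ {s t} → Walk (contraction E kept gone) s t → Walk E s t
  uncontract-walk k→g back ε = ε
  uncontract-walk {kept} {gone} k→g back (_◅_ {x} {y} e w) with to (contraction-cases kept gone x y) e
  ... | _ , inj₁ e = e ◅ uncontract-walk k→g back w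
  ... | _ , inj₂ (inj₁ (refl , e)) = k→g ◅ e ◅ uncontract-walk k→g back w
  ... | _ , inj₂ (inj₂ (refl , e)) = back x e ◅◅ uncontract-walk k→g back w

-- Minimal minors

module _ (H : Digraph n) where

  dropEdge : Fin n → Fin n → Digraph n
  dropEdge u v = record
    { V = V H
    ; E = withoutEdge (E H) u v
    ; E⊆V = λ x y e → E⊆V H x y (proj₁ (to (withoutEdge-⇔ (E H) u v x y) e)) }

  dropVertex : Fin n → Digraph n
  dropVertex v = record
    { V = V H - v
    ; E = withoutVertex (E H) v
    ; E⊆V = λ x y e → let e , x≢v , y≢v = to (withoutVertex-⇔ (E H) v x y) e
                          x∈V , y∈V = E⊆V H x y e
                      in x∈p∧x≢y⇒x∈p-y x∈V x≢v , x∈p∧x≢y⇒x∈p-y y∈V y≢v }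

  contract : ∀ kept gone → T (E H kept gone) → Digraph n
  contract kept gone k→g = record
    { V = V H - gone
    ; E = contraction (E H) kept gone
    ; E⊆V = λ x y e → let (x≢y , x≢g , y≢g) , e = to (contraction-cases (E H) kept gone x y) e
                          x∈V , y∈V = ends e
                      in x∈p∧x≢y⇒x∈p-y x∈V x≢g , x∈p∧x≢y⇒x∈p-y y∈V y≢g }
    where
    k∈V = proj₁ (E⊆V H kept gone k→g)

    ends : ∀ {x y} → T (E H x y) ⊎ (x ≡ kept × T (E H gone y)) ⊎ (y ≡ kept × T (E H x gone)) →
      x ∈ V H × y ∈ V H
    ends (inj₁ e) = E⊆V H _ _ e
    ends (inj₂ (inj₁ (refl , e))) = k∈V , proj₂ (E⊆V H _ _ e)
    ends (inj₂ (inj₂ (refl , e))) = proj₁ (E⊆V H _ _ e) , k∈V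

─⇒∈ : ∀ {p q : Subset n} {v} → v ∈ p ─ q → v ∈ p
─⇒∈ {p = p} {q} = p─q⊆p p q

─⇒∉ : ∀ {p q : Subset n} {v} → v ∈ p ─ q → v ∉ q
─⇒∉ {p = _ ∷ _} {inside ∷ _} {zero} () here
─⇒∉ {p = _ ∷ _} {_ ∷ _} {suc _} (there v∈) (there v∈q) = ─⇒∉ v∈ v∈q

-- The map may depend on the proof of membership, as the code of a vertex does below, so injectivity
-- is asked for any two proofs.
injection⇒∣∣≤ : ∀ {m} (p : Subset n) (f : ∀ {v} → v ∈ p → Fin m) →
  (∀ {v w} (v∈ : v ∈ p) (w∈ : w ∈ p) → f v∈ ≡ f w∈ → v ≡ w) → ∣ p ∣ ≤ m
injection⇒∣∣≤ p f f-injective =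
  injective⇒≤ {f = f ∘ proj₂ ∘ element p} (element-injective p ∘ f-injective _ _)
  where
  element : ∀ {n} (p : Subset n) → Fin ∣ p ∣ → ∃[ v ] v ∈ p
  element (inside ∷ p) zero = zero , here
  element (inside ∷ p) (suc i) = Prod.map suc there (element p i)
  element (outside ∷ p) i = Prod.map suc there (element p i)

  element-injective : ∀ {n} (p : Subset n) {i j} →
    proj₁ (element p i) ≡ proj₁ (element p j) → i ≡ j
  element-injective (inside ∷ p) {zero} {zero} _ = refl
  element-injective (inside ∷ p) {suc i} {suc j} eq =
    cong suc (element-injective p (suc-injective eq))
  element-injective (outside ∷ p) eq = element-injective p (suc-injective eq)

index-injective : ∀ {A : Set} {x y : A} {xs} (x∈ : x List.∈ xs) (y∈ : y List.∈ xs) →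
  index x∈ ≡ index y∈ → x ≡ y
index-injective {xs = xs} x∈ y∈ eq =
  trans (lookup-index x∈) (trans (cong (at-index xs) eq) (sym (lookup-index y∈)))

∈-pairs : ∀ {P : PairSet n} {s t} → T (P s t) → (s , t) List.∈ pairs P
∈-pairs {s = s} {t} = ∈-filter⁺ _ (∈-cartesianProduct⁺ (∈-allFin s) (∈-allFin t))

order : Subset n → Digraph n → ℕ
order K H = ∣ V H ─ K ∣

order-drop : ∀ K (H : Digraph n) {v} → v ∈ V H → v ∉ K → ∣ V H - v ─ K ∣ < order K H
order-drop K H {v} v∈V v∉K = subst (λ S → ∣ S ∣ < order K H) (p─q─r≡p─r─q (V H) K ⁅ v ⁆)
  (x∈p⇒∣p-x∣<∣p∣ (x∈p∧x∉q⇒x∈p─q v∈V v∉K))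

module _ (K : Subset n) (P : PairSet n) (G : Digraph n) where

  Preserves : Digraph n → Set
  Preserves H = ∀ s t → T (P s t) → Reachable H s t ⇔ Reachable G s t

  -- The constructive failure of `Preserves`: a refused step must supply the pair of `P` that it
  -- would have spoiled.
  Distinguished : Digraph n → Set
  Distinguished H = ∃₂ λ s t → T (P s t) × ¬ (Reachable H s t ⇔ Reachable G s t)

  -- Decidability of reachability is carried along because the counting argument makes case
  -- distinctions on it; the closure computed by the program provides it.
  record Admissible (H : Digraph n) : Set where
    field
      isMinor   : Minor K G H
      terminals : K ⊆ V H
      preserves : Preserves H
      reach?    : ∀ s t → Dec (Reachable H s t)

  EdgeMinimal : Digraph n → Fin n → Fin n → Set
  EdgeMinimal H u v = T (E H u v) → Distinguished (dropEdge H u v)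

  VertexMinimal : Digraph n → Fin n → Fin n → Set
  VertexMinimal H u v =
    v ∉ K → ((e : T (E H u v)) → u ≢ v → Distinguished (contract H u v e)) ×
            (v ∈ V H → Distinguished (dropVertex H v))

  module Critical (P⊆K : PairsOf K P) {H : Digraph n} (adm : Admissible H)
    (edgeMinimal : ∀ u v → EdgeMinimal H u v)
    (vertexMinimal : ∀ u v → VertexMinimal H u v) where

    open Admissible adm

    _↝_ : Fin n → Fin n → Set
    _↝_ = Reachable H

    record CriticalFor (u v s t : Fin n) : Set where
      field
        connected : s ↝ t
        cut       : ¬ Walk (withoutEdge (E H) u v) s t

    open CriticalFor

    -- Deleting an edge only loses walks. As `H` preserves reachability on `P`, a pair spoiled by
    -- the deletion is connected in `H` and disconnected without the edge.
    critical : ∀ u v → T (E H u v) → ∃₂ λ s t → T (P s t) × CriticalFor u v s t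
    critical u v e with edgeMinimal u v e
    ... | s , t , st∈P , ≁ = s , t , st∈P , record { connected = s↝t ; cut = cut′ }
      where
      weaken : Walk (withoutEdge (E H) u v) s t → s ↝ t
      weaken = Star.map (λ {x} {y} → proj₁ ∘ to (withoutEdge-⇔ (E H) u v x y))

      cut′ : ¬ Walk (withoutEdge (E H) u v) s t
      cut′ w = ≁ (mk⇔ (to (preserves s t st∈P) ∘ weaken) (λ _ → w))

      s↝t : s ↝ t
      s↝t with reach? s t
      ... | yes w = w
      -- Were `t` unreachable from `s` in `H`, it would be unreachable in `G` and after the deletion
      -- too, so the pair would not be spoiled.
      ... | no ¬w = contradiction (mk⇔ (to (preserves s t st∈P) ∘ weaken)
                      (λ w → contradiction (from (preserves s t st∈P) w) ¬w)) ≁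

    source≢target : ∀ {u v} → T (E H u v) → u ≢ v
    source≢target {u} {v} e refl =
      let _ , _ , _ , c = critical u v e in cut c (avoidLoop (E H) v (connected c))

    split : ∀ {u v s t} → CriticalFor u v s t → s ↝ u × v ↝ t
    split {u} {v} c with avoidEdge (E H) u v (connected c)
    ... | inj₁ w = contradiction w (cut c)
    ... | inj₂ ws = ws

    detour : ∀ {u v s t x y} → CriticalFor u v s t → T (E H x y) → ¬ (x ≡ u × y ≡ v) →
      Walk (withoutEdge (E H) u v) s x → ¬ Walk (withoutEdge (E H) u v) y t
    detour {u} {v} {x = x} {y} c e ≢uv w₁ w₂ =
      cut c (w₁ ◅◅ from (withoutEdge-⇔ (E H) u v x y) (e , ≢uv) ◅ w₂)

    -- A walk from `s` to `t` through `(u , v)` has to take `(u′ , v′)` as well, either before `u`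
    -- or after `v`.
    comparable : ∀ {u v u′ v′ s t} → T (E H u v) → v ≢ v′ →
      CriticalFor u v s t → CriticalFor u′ v′ s t → v′ ↝ u ⊎ v ↝ u′
    comparable {u′ = u′} {v′} e v≢v′ c c′
      with avoidEdge (E H) u′ v′ (proj₁ (split c)) | avoidEdge (E H) u′ v′ (proj₂ (split c))
    ... | inj₂ (_ , w) | _ = inj₁ w
    ... | inj₁ _ | inj₂ (w , _) = inj₂ w
    ... | inj₁ w₁ | inj₁ w₂ = contradiction w₂ (detour c′ e (v≢v′ ∘ proj₂) w₁)

    record Branching (v : Fin n) (π : (Fin n × Fin n) × (Fin n × Fin n)) : Set where
      field
        u₁ u₂     : Fin n
        e₁        : T (E H u₁ v)
        e₂        : T (E H u₂ v)
        u₂≢u₁     : u₂ ≢ u₁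
        critical₁ : CriticalFor u₁ v (proj₁ (proj₁ π)) (proj₂ (proj₁ π))
        critical₂ : CriticalFor u₂ v (proj₁ (proj₂ π)) (proj₂ (proj₂ π))
        acyclic   : ∀ y → T (E H y v) → ¬ v ↝ y

    open Branching

    -- Running to v for the first pair, on to v′ for the second and then again for
    -- the first enters v′ through the second edge, so avoids the first one.
    not-before : ∀ {v v′ π} (b : Branching v π) (b′ : Branching v′ π) → v ≢ v′ →
      ¬ v ↝ u₁ b′
    not-before {v} {v′} b b′ v≢v′ v↝u₁′
      with comparable (e₂ b) v≢v′ (critical₂ b) (critical₂ b′)
    -- From `v′` over `u₂` and `v` to `u₁ b′` and back to `v′`: a cycle through `v′`.
    ... | inj₁ v′↝u₂ = acyclic b′ _ (e₁ b′) (v′↝u₂ ◅◅ e₂ b ◅ v↝u₁′)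
    ... | inj₂ v↝u₂′
      with avoidEdge (E H) (u₁ b′) v′ (proj₁ (split (critical₁ b)))
         | avoidEdge (E H) (u₁ b′) v′ v↝u₂′
         | avoidEdge (E H) (u₁ b′) v′ (proj₂ (split (critical₁ b′)))
    -- If any of the three parts of the combined walk took the first edge into `v′`, that part would
    -- lead on from `v′` to an in-neighbour of `v′`, closing a cycle.
    ... | inj₂ (_ , v′↝u₁) | _ | _ = acyclic b′ _ (e₁ b′) (v′↝u₁ ◅◅ e₁ b ◅ v↝u₁′)
    ... | _ | inj₂ (_ , v′↝u₂′) | _ = acyclic b′ _ (e₂ b′) v′↝u₂′
    ... | _ | _ | inj₂ (v′↝u₁′ , _) = acyclic b′ _ (e₁ b′) v′↝u₁′
    ... | inj₁ w₁ | inj₁ w₂ | inj₁ w₃ =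
      detour (critical₁ b′) (e₂ b′) (u₂≢u₁ b′ ∘ proj₁)
        (w₁ ◅◅ from (withoutEdge-⇔ (E H) _ _ _ _) (e₁ b , v≢v′ ∘ proj₂) ◅ w₂) w₃

    -- The first pair is critical for an edge into each vertex, so one of the two vertices comes
    -- before the other, and `not-before` excludes both orders.
    branching-injective : ∀ {v v′ π} → Branching v π → Branching v′ π → v ≡ v′
    branching-injective {v} {v′} b b′ with v ≟ v′
    ... | yes v≡v′ = v≡v′
    ... | no v≢v′ with comparable (e₁ b) v≢v′ (critical₁ b) (critical₁ b′)
    ...   | inj₁ v′↝u₁ = contradiction v′↝u₁ (not-before b′ b (v≢v′ ∘ sym))
    ...   | inj₂ v↝u₁′ = contradiction v↝u₁′ (not-before b b′ v≢v′)

    module _ {v : Fin n} (v∈V : v ∈ V H) (v∉K : v ∉ K) where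

      source : ∃[ u ] T (E H u v)
      source with any? (λ u → T? (E H u v))
      ... | yes e = e
      -- The first `v` is arbitrary, as the clause on deletion does not mention the in-neighbour.
      -- Walks for `P` start at terminals, so none of them visits the sourceless `v`.
      ... | no sourceless with proj₂ (vertexMinimal v v v∉K) v∈V
      ...   | s , t , st∈P , ≁ = contradiction (mk⇔
        (to (preserves s t st∈P) ∘ Star.map (λ {x} {y} → proj₁ ∘ to (withoutVertex-⇔ (E H) v x y)))
        (avoidVertex (E H) (λ u e → sourceless (u , e)) s≢v ∘ from (preserves s t st∈P))) ≁
        where
        s≢v : s ≢ v
        s≢v refl = v∉K (proj₁ (P⊆K s t st∈P))

      -- If all in-neighbours of `v` reached `u`, contracting `(u , v)` would create no reachability
      -- by `uncontract-walk`, contrary to minimality.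
      escape : ∀ {u} → T (E H u v) → ∃[ x ] (T (E H x v) × ¬ x ↝ u)
      escape {u} e with all? (λ x → T? (E H x v) →-dec reach? x u)
      ... | no ¬back = Prod.map₂ pick (¬∀⟶∃¬ n _ (λ x → T? (E H x v) →-dec reach? x u) ¬back)
        where
        pick : ∀ {x} → ¬ (T (E H x v) → x ↝ u) → T (E H x v) × ¬ x ↝ u
        pick {x} ¬x with T? (E H x v)
        ... | yes e = e , λ w → ¬x (λ _ → w)
        ... | no ¬e = contradiction (λ e → contradiction e ¬e) ¬x
      ... | yes back with proj₁ (vertexMinimal u v v∉K) e (source≢target e)
      ...   | s , t , st∈P , ≁ = contradiction (mk⇔
        (to (preserves s t st∈P) ∘ uncontract-walk (E H) e back)
        (λ w → subst₂ (Walk _) (rename-≢ s≢v) (rename-≢ t≢v)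
                 (contract-walk (E H) (source≢target e) (from (preserves s t st∈P) w)))) ≁
        where
        s≢v : s ≢ v
        s≢v refl = v∉K (proj₁ (P⊆K s t st∈P))
        t≢v : t ≢ v
        t≢v refl = v∉K (proj₂ (P⊆K s t st∈P))

      branching : ∃[ π ] ((proj₁ π List.∈ pairs P × proj₂ π List.∈ pairs P) × Branching v π)
      branching with source
      ... | u₁ , e₁ with escape e₁
      ... | u₂ , e₂ , u₂↛u₁ with critical u₁ v e₁ | critical u₂ v e₂
      ... | s₁ , t₁ , ∈P₁ , c₁ | s₂ , t₂ , ∈P₂ , c₂ =
        ((s₁ , t₁) , (s₂ , t₂)) , (∈-pairs ∈P₁ , ∈-pairs ∈P₂) , record
          { e₁ = e₁ ; e₂ = e₂ ; u₂≢u₁ = λ { refl → u₂↛u₁ ε }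
          ; critical₁ = c₁ ; critical₂ = c₂
          -- If `v` reached its in-neighbour `y`, every in-neighbour of `v` would reach `y` through
          -- `v`; the one given by `escape` does not.
          ; acyclic = λ y e v↝y → let x , e′ , x↛y = escape e in x↛y (e′ ◅ v↝y) }

    code : ∀ {v} → ∃[ π ] ((proj₁ π List.∈ pairs P × proj₂ π List.∈ pairs P) × Branching v π) →
      Fin (size P * size P)
    code (_ , (∈₁ , ∈₂) , _) = combine (index ∈₁) (index ∈₂)

    code-injective : ∀ {v w} b b′ → code {v} b ≡ code {w} b′ → v ≡ w
    code-injective (_ , (∈₁ , ∈₂) , b) (_ , (∈₁′ , ∈₂′) , b′) eq
      with combine-injective (index ∈₁) (index ∈₂) (index ∈₁′) (index ∈₂′) eq
    ... | eq₁ , eq₂ with index-injective ∈₁ ∈₁′ eq₁ | index-injective ∈₂ ∈₂′ eq₂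
    ... | refl | refl = branching-injective b b′

    order-bound : order K H ≤ size P ^ 2
    -- The square unfolds to `size P * (size P * 1)`.
    order-bound = subst (order K H ≤_) (cong (size P *_) (sym (ℕ.*-identityʳ (size P))))
      (injection⇒∣∣≤ (V H ─ K) (λ v∈ → code (branching (─⇒∈ v∈) (─⇒∉ v∈)))
        (λ v∈ w∈ → code-injective (branching (─⇒∈ v∈) (─⇒∉ v∈)) (branching (─⇒∈ w∈) (─⇒∉ w∈))))

-- Bounded loops

infixr 20 _⊳_
infix 25 _[_,_]≔_

-- Each loop runs as often as there are vertices, so the semantics `run` is a total function and the
-- time bound `cost` a structural recursion.
data Loop : Set where
  done     : Loop
  _[_,_]≔_ : ℕ → Expr → Expr → Expr → Loop
  _⊳_      : Loop → Loop → Loop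
  unless   : Expr → Loop → Loop
  for      : ℕ → Loop → Loop

cell : ℕ → Expr
cell x = x [ lit 0 , lit 0 ]

compile : Loop → Program
compile done = skip
compile (a [ e , f ]≔ g) = set a e f g
compile (p ⊳ q) = compile p ⨾ compile q
compile (unless e p) = ifte e skip (compile p)
compile (for x p) = set x (lit 0) (lit 0) (lit 0) ⨾
  -- Subtraction is truncated, so the test is nonzero exactly while the counter is below the bound.
  while (cell 0 ⊖ cell x) (compile p ⨾ set x (lit 0) (lit 0) (cell x ⊕ lit 1))

repeat : (Store → Store) → ℕ → ℕ → Store → Store
repeat f x zero σ = write σ x 0 0 0
repeat f x (suc m) σ = let τ = f (repeat f x m σ) in write τ x 0 0 (τ x 0 0 + 1)

run : Loop → Store → Store
run done σ = σ
run (a [ e , f ]≔ g) σ = write σ a (eval σ e) (eval σ f) (eval σ g)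
run (p ⊳ q) σ = run q (run p σ)
run (unless e p) σ with eval σ e
... | zero = run p σ
... | suc _ = σ
run (for x p) σ = repeat (run p) x (σ 0 0 0) σ

writes : ℕ → Loop → Bool
writes a done = false
writes a (b [ _ , _ ]≔ _) = a ≡ᵇ b
writes a (p ⊳ q) = writes a p ∨ writes a q
writes a (unless _ p) = writes a p
writes a (for x p) = (a ≡ᵇ x) ∨ writes a p

-- Array 0 holds the number of vertices, which bounds every loop.
wellFormed : Loop → Bool
wellFormed done = true
wellFormed (a [ _ , _ ]≔ _) = not (0 ≡ᵇ a)
wellFormed (p ⊳ q) = wellFormed p ∧ wellFormed q
wellFormed (unless _ p) = wellFormed p
wellFormed (for x p) = (not (0 ≡ᵇ x) ∧ not (writes x p)) ∧ wellFormed p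

cost : Loop → ℕ → ℕ
cost done n = 1
cost (_ [ _ , _ ]≔ _) n = 1
cost (p ⊳ q) n = cost p n + cost q n
-- One unit for the test; the second unit lets a sum cover both branches, `skip` included.
cost (unless _ p) n = 1 + (1 + cost p n)
-- Resetting the counter, then `n` rounds of test, body and increment, then the failing test.
cost (for _ p) n = 1 + (n * (2 + cost p n) + 1)

write-≢ : ∀ σ {a b} i j m → (b ≡ᵇ a) ≡ false → ∀ i′ j′ → write σ a i j m b i′ j′ ≡ σ b i′ j′
write-≢ σ i j m b≢a i′ j′ rewrite b≢a = refl

≡ᵇ-refl : ∀ m → (m ≡ᵇ m) ≡ true
≡ᵇ-refl zero = refl
≡ᵇ-refl (suc m) = ≡ᵇ-refl m

write-≡ : ∀ σ a i j m → write σ a i j m a i j ≡ m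
write-≡ σ a i j m rewrite ≡ᵇ-refl a | ≡ᵇ-refl i | ≡ᵇ-refl j = refl

unchanged : ∀ p {a} → writes a p ≡ false → ∀ σ i j → run p σ a i j ≡ σ a i j
repeat-unchanged : ∀ x p {a} → writes a (for x p) ≡ false → ∀ m σ i j →
  repeat (run p) x m σ a i j ≡ σ a i j

unchanged done _ σ i j = refl
unchanged (b [ e , f ]≔ g) a≢b σ = write-≢ σ (eval σ e) (eval σ f) (eval σ g) a≢b
unchanged (p ⊳ q) ∉pq σ i j =
  trans (unchanged q (∨-conicalʳ _ _ ∉pq) (run p σ) i j) (unchanged p (∨-conicalˡ _ _ ∉pq) σ i j)
unchanged (unless e p) ∉p σ i j with eval σ e
... | zero = unchanged p ∉p σ i j
... | suc _ = refl
unchanged (for x p) ∉xp σ = repeat-unchanged x p ∉xp (σ 0 0 0) σ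

repeat-unchanged x p {a} ∉xp zero σ = write-≢ σ {x} {a} 0 0 0 (∨-conicalˡ _ _ ∉xp)
repeat-unchanged x p {a} ∉xp (suc m) σ i j =
  trans (write-≢ (run p (repeat (run p) x m σ)) {x} {a} 0 0 _ (∨-conicalˡ _ _ ∉xp) i j)
    (trans (unchanged p (∨-conicalʳ (a ≡ᵇ x) _ ∉xp) (repeat (run p) x m σ) i j)
      (repeat-unchanged x p ∉xp m σ i j))

repeat-counts : ∀ x p → writes x p ≡ false → ∀ m σ → repeat (run p) x m σ x 0 0 ≡ m
repeat-counts x p ∉p zero σ = write-≡ σ x 0 0 0
repeat-counts x p ∉p (suc m) σ = trans (write-≡ (run p (repeat (run p) x m σ)) x 0 0 _)
  (trans (cong (_+ 1) (trans (unchanged p ∉p (repeat (run p) x m σ) 0 0) (repeat-counts x p ∉p m σ)))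
    (ℕ.+-comm m 1))

bound-unwritten : ∀ p → T (wellFormed p) → writes 0 p ≡ false
bound-unwritten done _ = refl
bound-unwritten (a [ _ , _ ]≔ _) wf = to T-not-≡ wf
bound-unwritten (p ⊳ q) wf = let wf-p , wf-q = to T-∧ wf in
  cong₂ _∨_ (bound-unwritten p wf-p) (bound-unwritten q wf-q)
bound-unwritten (unless _ p) wf = bound-unwritten p wf
bound-unwritten (for x p) wf = let wf-x , wf-p = to T-∧ wf in
  cong₂ _∨_ (to T-not-≡ (proj₁ (to T-∧ wf-x))) (bound-unwritten p wf-p)

compile-correct : ∀ p → T (wellFormed p) → ∀ {n σ} → σ 0 0 0 ≡ n →
  ∃[ t ] (⟨ compile p , σ ⟩⇓[ t ] run p σ × t ≤ cost p n)
compile-correct done _ _ = 1 , skip⇓ , ℕ.≤-refl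
compile-correct (a [ e , f ]≔ g) _ _ = 1 , set⇓ , ℕ.≤-refl
compile-correct (p ⊳ q) wf {n} {σ} σ0≡n =
  let s , ⇓ , s≤ = compile-correct p (proj₁ (to T-∧ wf)) σ0≡n
      t , ⇓′ , t≤ = compile-correct q (proj₂ (to T-∧ wf))
        (trans (unchanged p (bound-unwritten p (proj₁ (to T-∧ wf))) σ 0 0) σ0≡n)
  in s + t , seq⇓ ⇓ ⇓′ , ℕ.+-mono-≤ s≤ t≤
compile-correct (unless e p) wf {σ = σ} σ0≡n with eval σ e in eq
... | zero with compile-correct p wf σ0≡n
...   | t , ⇓ , t≤ = suc t , else⇓ eq ⇓ , s≤s (ℕ.m≤n⇒m≤1+n t≤)
compile-correct (unless e p) wf {σ = σ} σ0≡n | suc _ =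
  2 , then⇓ (λ ≡0 → ℕ.0≢1+n (trans (sym ≡0) eq)) skip⇓ , s≤s (s≤s z≤n)
compile-correct (for x p) wf {n} {σ} refl =
  let wf-x , wf-p = to T-∧ wf
      ∉p = to T-not-≡ (proj₂ (to T-∧ wf-x))
      t , ⇓ , t≤ = iterate ∉p (bound-unwritten (for x p) wf) wf-p n 0 (ℕ.+-identityʳ n)
  in 1 + t , seq⇓ set⇓ ⇓ , s≤s t≤
  where
  -- `m` rounds have been run and `r` remain. The induction is on `r` because the derivation of a
  -- `while` is built from its first round.
  iterate : writes x p ≡ false → writes 0 (for x p) ≡ false → T (wellFormed p) →
    ∀ r m → r + m ≡ n → ∃[ t ]
      (⟨ while (cell 0 ⊖ cell x) (compile p ⨾ set x (lit 0) (lit 0) (cell x ⊕ lit 1)) ,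
         repeat (run p) x m σ ⟩⇓[ t ] repeat (run p) x n σ
       × t ≤ r * (2 + cost p n) + 1)
  iterate ∉p ∉0 wf-p zero m refl = 1 ,
    stop⇓ (trans (cong₂ _∸_ (repeat-unchanged x p ∉0 m σ 0 0) (repeat-counts x p ∉p m σ)) (ℕ.n∸n≡0 m)) ,
    ℕ.≤-refl
  iterate ∉p ∉0 wf-p (suc r) m r+m≡n
    with compile-correct p wf-p {n} {repeat (run p) x m σ} (repeat-unchanged x p ∉0 m σ 0 0)
       | iterate ∉p ∉0 wf-p r (suc m) (trans (ℕ.+-suc r m) r+m≡n)
  ... | t , ⇓ , t≤ | t′ , ⇓′ , t′≤ = suc (t + 1 + t′) , loop⇓ running (seq⇓ ⇓ set⇓) ⇓′ , bound
    where
    σ′ = repeat (run p) x m σ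

    running : σ′ 0 0 0 ∸ σ′ x 0 0 ≢ 0
    running ≡0 = ℕ.1+n≢0 (trans (sym (ℕ.m+n∸n≡m (suc r) m)) (trans (cong (_∸ m) r+m≡n)
      (trans (sym (cong₂ _∸_ (repeat-unchanged x p ∉0 m σ 0 0) (repeat-counts x p ∉p m σ))) ≡0)))

    bound : suc (t + 1 + t′) ≤ (2 + cost p n) + r * (2 + cost p n) + 1
    bound = begin
      suc (t + 1 + t′)         ≡⟨ cong (λ k → suc (k + t′)) (ℕ.+-comm t 1) ⟩
      2 + t + t′               ≤⟨ ℕ.+-mono-≤ (s≤s (s≤s t≤)) t′≤ ⟩
      2 + cost p n + (r * (2 + cost p n) + 1) ≡⟨ ℕ.+-assoc (2 + cost p n) _ 1 ⟨
      2 + cost p n + r * (2 + cost p n) + 1   ∎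
      where open ≤-Reasoning

-- Polynomial bounds

Polynomial : (ℕ → ℕ) → Set
Polynomial f = ∃[ c ] ∃[ d ] (∀ n → f n ≤ c * suc n ^ d)

polynomial-const : ∀ k → Polynomial (λ _ → k)
polynomial-const k = k , 0 , λ n → ℕ.≤-reflexive (sym (ℕ.*-identityʳ k))

polynomial-id : Polynomial id
polynomial-id = 1 , 1 , λ n → ℕ.≤-trans (ℕ.n≤1+n n)
  (ℕ.≤-reflexive (sym (trans (ℕ.*-identityˡ _) (ℕ.*-identityʳ (suc n)))))

polynomial-+ : ∀ {f g} → Polynomial f → Polynomial g → Polynomial (λ n → f n + g n)
polynomial-+ {f} {g} (c , d , f≤) (c′ , d′ , g≤) = c + c′ , d + d′ , λ n → begin
  f n + g n                                        ≤⟨ ℕ.+-mono-≤ (f≤ n) (g≤ n) ⟩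
  c * suc n ^ d + c′ * suc n ^ d′                  ≤⟨ ℕ.+-mono-≤
    -- Powers grow with the exponent because the base `suc n` is never 0, which is why `Polynomial`
    -- does not use `n` as its base.
    (ℕ.*-monoʳ-≤ c (ℕ.^-monoʳ-≤ (suc n) (ℕ.m≤m+n d d′)))
    (ℕ.*-monoʳ-≤ c′ (ℕ.^-monoʳ-≤ (suc n) (ℕ.m≤n+m d′ d))) ⟩
  c * suc n ^ (d + d′) + c′ * suc n ^ (d + d′)     ≡⟨ ℕ.*-distribʳ-+ (suc n ^ (d + d′)) c c′ ⟨
  (c + c′) * suc n ^ (d + d′)                      ∎
  where open ≤-Reasoning

polynomial-* : ∀ {f g} → Polynomial f → Polynomial g → Polynomial (λ n → f n * g n)
polynomial-* {f} {g} (c , d , f≤) (c′ , d′ , g≤) = c * c′ , d + d′ , λ n → begin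
  f n * g n                                ≤⟨ ℕ.*-mono-≤ (f≤ n) (g≤ n) ⟩
  c * suc n ^ d * (c′ * suc n ^ d′)        ≡⟨ ℕ.[m*n]*[o*p]≡[m*o]*[n*p] c _ c′ _ ⟩
  c * c′ * (suc n ^ d * suc n ^ d′)        ≡⟨ cong (c * c′ *_) (ℕ.^-distribˡ-+-* (suc n) d d′) ⟨
  c * c′ * suc n ^ (d + d′)                ∎
  where open ≤-Reasoning

cost-polynomial : ∀ p → Polynomial (cost p)
cost-polynomial done = polynomial-const 1
cost-polynomial (_ [ _ , _ ]≔ _) = polynomial-const 1
cost-polynomial (p ⊳ q) = polynomial-+ (cost-polynomial p) (cost-polynomial q)
cost-polynomial (unless _ p) = polynomial-+ (polynomial-const 2) (cost-polynomial p)
cost-polynomial (for _ p) = polynomial-+ (polynomial-const 1)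
  (polynomial-+ (polynomial-* polynomial-id (polynomial-+ (polynomial-const 2) (cost-polynomial p)))
    (polynomial-const 1))

^-distribʳ-* : ∀ m n d → (m * n) ^ d ≡ m ^ d * n ^ d
^-distribʳ-* m n zero = refl
^-distribʳ-* m n (suc d) = trans (cong (m * n *_) (^-distribʳ-* m n d))
  (ℕ.[m*n]*[o*p]≡[m*o]*[n*p] m n (m ^ d) (n ^ d))

-- For positive `n`, `suc n` is at most `2 * n`, which costs a factor `2 ^ d`; the additive constant
-- takes care of `n = 0`.
polynomial-bound : ∀ {f} → Polynomial f → ∃[ c ] ∃[ d ] (∀ n → f n ≤ c * n ^ d + c)
polynomial-bound {f} (c , d , f≤) = c * 2 ^ d , d , bound
  where
  open ≤-Reasoning
  bound : ∀ n → f n ≤ c * 2 ^ d * n ^ d + c * 2 ^ d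
  bound zero = begin
    f 0                                  ≤⟨ f≤ 0 ⟩
    c * 1 ^ d                            ≤⟨ ℕ.*-monoʳ-≤ c (ℕ.^-monoˡ-≤ d (s≤s z≤n)) ⟩
    c * 2 ^ d                            ≤⟨ ℕ.m≤n+m _ _ ⟩
    c * 2 ^ d * 0 ^ d + c * 2 ^ d        ∎
  bound n@(suc m) = begin
    f n                                  ≤⟨ f≤ n ⟩
    c * suc n ^ d                        ≤⟨ ℕ.*-monoʳ-≤ c (ℕ.^-monoˡ-≤ d 1+n≤2*n) ⟩
    c * (2 * n) ^ d                      ≡⟨ cong (c *_) (^-distribʳ-* 2 n d) ⟩
    c * (2 ^ d * n ^ d)                  ≡⟨ ℕ.*-assoc c (2 ^ d) _ ⟨
    c * 2 ^ d * n ^ d                    ≤⟨ ℕ.m≤m+n _ _ ⟩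
    c * 2 ^ d * n ^ d + c * 2 ^ d        ∎
    where
    1+n≤2*n : suc n ≤ 2 * n
    1+n≤2*n = s≤s (subst (n ≤_) (sym (cong (m +_) (ℕ.+-identityʳ n))) (ℕ.m≤n+m n m))

-- Rules for loops

-- For numerals a and b ≢ a, write σ a i j m b reduces to σ b, so id proves Frame I a for
-- every I that does not read array a.
Frame : (Store → Set) → ℕ → Set
Frame I a = ∀ {σ i j m} → I σ → I (write σ a i j m)

≡ᵇ-comm : ∀ m n → (m ≡ᵇ n) ≡ (n ≡ᵇ m)
≡ᵇ-comm zero zero = refl
≡ᵇ-comm zero (suc n) = refl
≡ᵇ-comm (suc m) zero = refl
≡ᵇ-comm (suc m) (suc n) = ≡ᵇ-comm m n

frame-cell : ∀ {a b i j m} → (b ≡ᵇ a) ≡ false → Frame (λ σ → σ b i j ≡ m) a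
frame-cell {i = i} {j} b≢a {σ} {k} {l} {m} eq = trans (write-≢ σ k l m b≢a i j) eq

record Triple (I : Store → Set) (p : Loop) (Q : Store → Set) : Set where
  constructor triple
  field apply : ∀ σ → I σ → Q (run p σ)

open Triple public

module _ {I J Q : Store → Set} where

  seq-rule : ∀ {p q} → Triple I p J → Triple J q Q → Triple I (p ⊳ q) Q
  seq-rule P R = triple λ σ Iσ → apply R _ (apply P σ Iσ)

  weaken-pre : ∀ {p} → (∀ {σ} → I σ → J σ) → Triple J p Q → Triple I p Q
  weaken-pre I⇒J P = triple λ σ Iσ → apply P σ (I⇒J Iσ)

  weaken-post : ∀ {p} → (∀ {σ} → J σ → Q σ) → Triple I p J → Triple I p Q
  weaken-post J⇒Q P = triple λ σ Iσ → J⇒Q (apply P σ Iσ)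

∃-rule : ∀ {A : Set} {I : A → Store → Set} {p Q} →
  (∀ a → Triple (I a) p Q) → Triple (λ σ → ∃[ a ] I a σ) p Q
∃-rule P = triple λ σ (a , Iσ) → apply (P a) σ Iσ

-- The invariant is indexed by the number of completed rounds and by a ghost value, such as the
-- current minor, which every round may replace.
for-rule : {A : Set} (I : ℕ → A → Store → Set) → ∀ x p → writes x p ≡ false →
  (∀ {m a} → Frame (I m a) x) →
  (∀ (u : Fin n) {a σ} → σ x 0 0 ≡ toℕ u → I (toℕ u) a σ →
    ∃[ a′ ] I (suc (toℕ u)) a′ (run p σ)) →
  ∀ {a σ} → σ 0 0 0 ≡ n → I 0 a σ → ∃[ a′ ] I n a′ (run (for x p) σ)
for-rule {n} I x p ∉p fr body {a} {σ} refl I₀ = go n ℕ.≤-refl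
  where
  go : ∀ m → m ≤ n → ∃[ a′ ] I m a′ (repeat (run p) x m σ)
  go zero _ = a , fr I₀
  go (suc m) m<n with go m (ℕ.<⇒≤ m<n)
  ... | a , Iₘ = next (fromℕ< m<n) (toℕ-fromℕ< m<n) Iₘ
    where
    next : ∀ u {m a} → toℕ u ≡ m → I m a (repeat (run p) x m σ) →
      ∃[ a′ ] I (suc m) a′ (repeat (run p) x (suc m) σ)
    next u refl Iₘ = Prod.map₂ fr (body u (repeat-counts x p ∉p (toℕ u) σ) Iₘ)

-- A round establishes `Φ` at its own index and keeps it wherever it held, so after `m` rounds it
-- holds at all indices below `m`.
forall-rule : {A : Set} (I : A → Store → Set) (Φ : Fin n → A → Store → Set) → ∀ x p →
  writes x p ≡ false → (∀ {a} → Frame (I a) x) → (∀ {u a} → Frame (Φ u a) x) →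
  (∀ u {a σ} → σ x 0 0 ≡ toℕ u → I a σ →
    ∃[ a′ ] (I a′ (run p σ) × Φ u a′ (run p σ) × (∀ w → Φ w a σ → Φ w a′ (run p σ)))) →
  ∀ {a σ} → σ 0 0 0 ≡ n → I a σ →
  ∃[ a′ ] (I a′ (run (for x p) σ) × ∀ u → Φ u a′ (run (for x p) σ))
forall-rule {n} {A} I Φ x p ∉p frI frΦ body σ0≡n Iσ =
  let a , Ia , Φa = for-rule I′ x p ∉p (λ (Iσ , Φσ) → frI Iσ , λ w w< → frΦ (Φσ w w<)) step
                      σ0≡n (Iσ , λ _ ())
  in a , Ia , λ u → Φa u (toℕ<n u)
  where
  I′ : ℕ → A → Store → Set
  I′ m a σ = I a σ × ∀ w → toℕ w < m → Φ w a σ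

  step : ∀ u {a σ} → σ x 0 0 ≡ toℕ u → I′ (toℕ u) a σ → ∃[ a′ ] I′ (suc (toℕ u)) a′ (run p σ)
  step u x≡u (Iσ , Φσ) with body u x≡u Iσ
  ... | a′ , I′ , Φu , keep = a′ , I′ , λ where
    w (s≤s w≤u) → Sum.[ keep w ∘ Φσ w , (λ w≡u → subst (λ v → Φ v a′ _) (sym (toℕ-injective w≡u)) Φu) ]
      (ℕ.m≤n⇒m<n∨m≡n w≤u)

forall²-rule : {A : Set} (I : A → Store → Set) (Φ : Fin n → Fin n → A → Store → Set) → ∀ x y p →
  writes x (for y p) ≡ false → writes y p ≡ false →
  (∀ {a} → Frame (I a) x) → (∀ {a} → Frame (I a) y) →
  (∀ {u v a} → Frame (Φ u v a) x) → (∀ {u v a} → Frame (Φ u v a) y) →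
  (∀ {a σ} → I a σ → σ 0 0 0 ≡ n) →
  (∀ u v {a σ} → σ x 0 0 ≡ toℕ u → σ y 0 0 ≡ toℕ v → I a σ →
    ∃[ a′ ] (I a′ (run p σ) × Φ u v a′ (run p σ) × (∀ w z → Φ w z a σ → Φ w z a′ (run p σ)))) →
  ∀ {a σ} → I a σ →
  ∃[ a′ ] (I a′ (run (for x (for y p)) σ) × ∀ u v → Φ u v a′ (run (for x (for y p)) σ))
forall²-rule {n} {A} I Φ x y p ∉x ∉y frIx frIy frΦx frΦy bound body Iσ =
  forall-rule I (λ u a σ → ∀ v → Φ u v a σ) x (for y p) ∉x frIx (λ Φσ v → frΦx (Φσ v)) row
    (bound Iσ) Iσ
  where
  row : ∀ u {a σ} → σ x 0 0 ≡ toℕ u → I a σ → _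
  row u {a₀} {σ₀} x≡u Iσ
    -- The inner invariant refers back to the state in which the row began, because the outer rule
    -- asks what the whole row preserves.
    with forall-rule (λ a σ → σ x 0 0 ≡ toℕ u × I a σ × ∀ w z → Φ w z a₀ σ₀ → Φ w z a σ)
           (λ v → Φ u v) y p ∉y
           (λ {a} {σ} {i} {j} {m} (x≡u , Iσ , keep) →
              frame-cell {y} {x} (∨-conicalˡ _ _ ∉x) {σ} {i} {j} {m} x≡u ,
              frIy Iσ , λ w z Φwz → frΦy (keep w z Φwz))
           frΦy
           (λ v {a} {σ} y≡v (x≡u , Iσ , keep) → let a′ , I′ , Φ′ , keep′ = body u v x≡u y≡v Iσ in
              a′ , (trans (unchanged p (∨-conicalʳ (x ≡ᵇ y) _ ∉x) σ 0 0) x≡u , I′ ,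
                    λ w z Φwz → keep′ w z (keep w z Φwz)) , Φ′ , keep′ u)
           (bound Iσ) (x≡u , Iσ , λ _ _ → id)
  ... | a′ , (_ , I′ , keep) , Φ′ = a′ , I′ , Φ′ , λ w Φw z → keep w z (Φw z)

-- Boolean matrices in arrays

-- Besides arrays 0 to 5, which hold the input and the current minor: 6 is the
-- reachability of the candidate in 9, 7 that of the input, 8 is scratch, 16 the result
-- of a search, and 10 to 15 are loop counters, with 13 and 14 for the u and v of a step.

Stores : (ℕ → ℕ → ℕ) → PairSet n → Set
Stores M R = ∀ u v → M (toℕ u) (toℕ v) ≡ bit (R u v)

-- One of the two truncated differences is 0 and their sum is the distance, which is 0 only for
-- equal arguments.
∸-equal : ∀ (u v : Fin n) →
  1 ∸ ((toℕ u ∸ toℕ v) + (toℕ v ∸ toℕ u)) ≡ bit (does (u ≟ v))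
∸-equal zero zero = refl
∸-equal zero (suc v) = ℕ.0∸n≡0 (toℕ v)
∸-equal (suc u) zero = ℕ.0∸n≡0 (toℕ u + 0)
∸-equal (suc u) (suc v) = ∸-equal u v

not′ : Expr → Expr
not′ e = lit 1 ⊖ e

-- Two negations cut a positive sum down to 1, which gives disjunction; conjunction follows by De
-- Morgan. The test for equality serves bits and vertex numbers alike.
_and_ _or_ _equals_ : Expr → Expr → Expr
e and f = not′ (not′ e ⊕ not′ f)
e or f = not′ (not′ (e ⊕ f))
e equals f = not′ ((e ⊖ f) ⊕ (f ⊖ e))

infix 10 _equals_
infixr 9 _and_
infixr 8 _or_

record Holds (σ : Store) (e : Expr) (b : Bool) : Set where
  constructor holds
  field value : eval σ e ≡ bit b

open Holds

module _ {σ : Store} where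

  eval-not : ∀ {e b} → Holds σ e b → Holds σ (not′ e) (not b)
  eval-not {b = true} (holds e≡b) = holds (cong (1 ∸_) e≡b)
  eval-not {b = false} (holds e≡b) = holds (cong (1 ∸_) e≡b)

  eval-and : ∀ {e f b c} → Holds σ e b → Holds σ f c → Holds σ (e and f) (b ∧ c)
  eval-and {b = b} {c} (holds e≡b) (holds f≡c) =
    holds (trans (cong₂ (λ k l → 1 ∸ ((1 ∸ k) + (1 ∸ l))) e≡b f≡c) (table b c))
    where
    table : ∀ b c → 1 ∸ ((1 ∸ bit b) + (1 ∸ bit c)) ≡ bit (b ∧ c)
    table true true = refl
    table true false = refl
    table false true = refl
    table false false = refl

  eval-or : ∀ {e f b c} → Holds σ e b → Holds σ f c → Holds σ (e or f) (b ∨ c)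
  eval-or {b = b} {c} (holds e≡b) (holds f≡c) =
    holds (trans (cong₂ (λ k l → 1 ∸ (1 ∸ (k + l))) e≡b f≡c) (table b c))
    where
    table : ∀ b c → 1 ∸ (1 ∸ (bit b + bit c)) ≡ bit (b ∨ c)
    table true true = refl
    table true false = refl
    table false true = refl
    table false false = refl

  eval-equals : ∀ {e f b c} → Holds σ e b → Holds σ f c → Holds σ (e equals f) (not (b xor c))
  eval-equals {b = b} {c} (holds e≡b) (holds f≡c) =
    holds (trans (cong₂ (λ k l → 1 ∸ ((k ∸ l) + (l ∸ k))) e≡b f≡c) (table b c))
    where
    table : ∀ b c → 1 ∸ ((bit b ∸ bit c) + (bit c ∸ bit b)) ≡ bit (not (b xor c))
    table true true = refl
    table true false = refl
    table false true = refl
    table false false = refl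

  eval-≟ : ∀ {x y} {u v : Fin n} → σ x 0 0 ≡ toℕ u → σ y 0 0 ≡ toℕ v →
    Holds σ (cell x equals cell y) (does (u ≟ v))
  eval-≟ {u = u} {v} x≡u y≡v =
    holds (trans (cong₂ (λ k l → 1 ∸ ((k ∸ l) + (l ∸ k))) x≡u y≡v) (∸-equal u v))

  eval-cell : ∀ {a} {R : PairSet n} {x y u v} → Stores (σ a) R → σ x 0 0 ≡ toℕ u → σ y 0 0 ≡ toℕ v →
    Holds σ (a [ cell x , cell y ]) (R u v)
  eval-cell {a = a} R≡ x≡u y≡v = holds (trans (cong₂ (σ a) x≡u y≡v) (R≡ _ _))

-- The test has the same value `b` in all states satisfying `I`, so either branch may be verified
-- with the truth of `b` as a fact independent of the state.
unless-rule : ∀ {I Q e p b} → (∀ {σ} → I σ → Holds σ e b) →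
  (T b → ∀ {σ} → I σ → Q σ) → (¬ T b → Triple I p Q) → Triple I (unless e p) Q
unless-rule {I} {Q} {e} {p} {b} eval-e skipped ran =
  triple λ σ Iσ → branch σ Iσ skipped ran (value (eval-e Iσ))
  where
  branch : ∀ {b} σ → I σ → (T b → ∀ {σ} → I σ → Q σ) → (¬ T b → Triple I p Q) →
    eval σ e ≡ bit b → Q (run (unless e p) σ)
  branch {b} σ Iσ skipped ran e≡b with eval σ e
  branch {true} σ Iσ skipped ran refl | _ = skipped tt Iσ
  branch {false} σ Iσ skipped ran refl | _ = apply (ran λ ()) σ Iσ

tabulate : ℕ → Expr → Loop
tabulate a e = for 10 (for 11 (a [ cell 10 , cell 11 ]≔ e))

write-update : ∀ σ a {i j m k i′ j′} → (i′ ≡ i → j′ ≡ j → m ≡ k) →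
  (¬ (i′ ≡ i × j′ ≡ j) → σ a i′ j′ ≡ k) → write σ a i j m a i′ j′ ≡ k
write-update σ a {i} {j} {i′ = i′} {j′} new old rewrite ≡ᵇ-refl a
  with i′ ≡ᵇ i in i≡ | j′ ≡ᵇ j in j≡
... | true | true = new (ℕ.≡ᵇ⇒≡ i′ i (from T-≡ i≡)) (ℕ.≡ᵇ⇒≡ j′ j (from T-≡ j≡))
... | true | false = old λ (_ , eq) → subst T j≡ (ℕ.≡⇒≡ᵇ j′ j eq)
... | false | _ = old λ (eq , _) → subst T i≡ (ℕ.≡⇒≡ᵇ i′ i eq)

-- The entries are justified by `J` alone, which survives writing to array `a`. So a matrix computed
-- from its own old entries has to pass through a second array.
tabulate-rule : ∀ {J : Store → Set} {F : PairSet n} a e → (10 ≡ᵇ a) ≡ false → (11 ≡ᵇ a) ≡ false →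
  Frame J 10 → Frame J 11 → Frame J a → (∀ {σ} → J σ → σ 0 0 0 ≡ n) →
  (∀ {σ u v} → J σ → σ 10 0 0 ≡ toℕ u → σ 11 0 0 ≡ toℕ v → Holds σ e (F u v)) →
  Triple J (tabulate a e) (λ σ → J σ × Stores (σ a) F)
tabulate-rule {n} {J} {F} a e 10≢a 11≢a fr₁₀ fr₁₁ frₐ bound eval-e = triple λ σ Jσ →
  proj₂ (forall²-rule (λ _ → J) (λ u v _ σ → σ a (toℕ u) (toℕ v) ≡ bit (F u v)) 10 11
    (a [ cell 10 , cell 11 ]≔ e) 10≢a 11≢a fr₁₀ fr₁₁
    (λ {u} {v} {_} {σ} {i} {j} {m} → frame-cell (trans (≡ᵇ-comm a 10) 10≢a) {σ} {i} {j} {m})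
    (λ {u} {v} {_} {σ} {i} {j} {m} → frame-cell (trans (≡ᵇ-comm a 11) 11≢a) {σ} {i} {j} {m})
    bound
    (λ u v {_} {σ} i≡u j≡v Jσ → tt , frₐ Jσ ,
      trans (cong₂ (λ i j → write σ a i j (eval σ e) a (toℕ u) (toℕ v)) i≡u j≡v)
        (trans (write-≡ σ a (toℕ u) (toℕ v) (eval σ e)) (value (eval-e Jσ i≡u j≡v))) ,
      λ w z old → write-update σ a (λ w≡i z≡j → trans (value (eval-e Jσ i≡u j≡v))
        (cong₂ (λ u v → bit (F u v)) (toℕ-injective (sym (trans w≡i i≡u)))
                                     (toℕ-injective (sym (trans z≡j j≡v))))) λ _ → old)
    {tt} {σ} Jσ)

pivot closure : Loop
pivot =
  tabulate 8 (6 [ cell 10 , cell 11 ] or 6 [ cell 10 , cell 12 ] and 6 [ cell 12 , cell 11 ]) ⊳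
  tabulate 6 (8 [ cell 10 , cell 11 ])
closure = tabulate 6 (cell 10 equals cell 11 or 9 [ cell 10 , cell 11 ]) ⊳ for 12 pivot

-- Warshall's algorithm. A matrix closed under composition at w stays so when it is closed
-- at k, so after all pivots it is transitive.
closure-rule : ∀ {J : Store → Set} {E : PairSet n} →
  All (Frame J) (6 ∷ 8 ∷ 10 ∷ 11 ∷ 12 ∷ []) → (∀ {σ} → J σ → σ 0 0 0 ≡ n) →
  (∀ {σ} → J σ → Stores (σ 9) E) →
  Triple J closure (λ σ → ∃[ R ] ((∀ u v → T (R u v) ⇔ Walk E u v) × J σ × Stores (σ 6) R))
closure-rule {n} {J} {E} (fr₆ ∷ fr₈ ∷ fr₁₀ ∷ fr₁₁ ∷ fr₁₂ ∷ []) bound input =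
  seq-rule
    (tabulate-rule {J = J} {F = R₀} 6 _ refl refl fr₁₀ fr₁₁ fr₆ bound
      λ Jτ i≡u j≡v → eval-or (eval-≟ i≡u j≡v) (eval-cell (input Jτ) i≡u j≡v))
    (triple saturate)
  where
  R₀ : PairSet n
  R₀ u v = does (u ≟ v) ∨ E u v

  R₀-sound : ∀ u v → T (R₀ u v) → Walk E u v
  R₀-sound u v r with to T-∨ r
  ... | inj₁ u≡v with refl ← to (T-does (u ≟ v)) u≡v = ε
  ... | inj₂ e = e ◅ ε

  I : PairSet n → Store → Set
  I R τ = J τ × Stores (τ 6) R ×
    (∀ u → T (R u u)) × (∀ u v → T (E u v) → T (R u v)) × (∀ u v → T (R u v) → Walk E u v)

  Closed : Fin n → PairSet n → Set
  Closed k R = ∀ u v → T (R u k) → T (R k v) → T (R u v)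

  complete : ∀ {R} → (∀ u → T (R u u)) → (∀ u v → T (E u v) → T (R u v)) → (∀ k → Closed k R) →
    ∀ {u v} → Walk E u v → T (R u v)
  complete reflexive edge closed ε = reflexive _
  complete reflexive edge closed (e ◅ w) =
    closed _ _ _ (edge _ _ e) (complete reflexive edge closed w)

  through : Fin n → PairSet n → PairSet n
  through k R u v = R u v ∨ (R u k ∧ R k v)

  through-⇔ : ∀ k R u v → T (through k R u v) ⇔ (T (R u v) ⊎ (T (R u k) × T (R k v)))
  through-⇔ k R u v = mk⇔ (Sum.map₂ (to T-∧) ∘ to T-∨) (from T-∨ ∘ Sum.map₂ (from T-∧))

  pivot-rule : ∀ k R → Triple (λ τ → τ 12 0 0 ≡ toℕ k × J τ × Stores (τ 6) R) pivot
    (λ τ → J τ × Stores (τ 6) (through k R))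
  pivot-rule k R = seq-rule
    (tabulate-rule {F = through k R} 8 _ refl refl
      (Prod.map₂ (Prod.map₁ fr₁₀)) (Prod.map₂ (Prod.map₁ fr₁₁)) (Prod.map₂ (Prod.map₁ fr₈))
      (bound ∘ proj₁ ∘ proj₂)
      λ (k≡ , _ , R≡) i≡u j≡v → eval-or (eval-cell R≡ i≡u j≡v)
        (eval-and (eval-cell R≡ i≡u k≡) (eval-cell R≡ k≡ j≡v)))
    (weaken-pre (λ ((_ , Jτ , _) , R′≡) → Jτ , R′≡)
      (weaken-post (λ ((Jτ , _) , R′≡) → Jτ , R′≡)
        (tabulate-rule {J = λ τ → J τ × Stores (τ 8) (through k R)} {F = through k R} 6 _ refl refl
          (Prod.map₁ fr₁₀) (Prod.map₁ fr₁₁) (Prod.map₁ fr₆) (bound ∘ proj₁)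
          λ (_ , R′≡) i≡u j≡v → eval-cell R′≡ i≡u j≡v)))

  extend : ∀ k {R τ} → τ 12 0 0 ≡ toℕ k → I R τ →
    ∃[ R′ ] (I R′ (run pivot τ) × Closed k R′ × (∀ w → Closed w R → Closed w R′))
  extend k {R} {τ} k≡ (Jτ , R≡ , reflexive , edge , sound) =
    let J′ , R′≡ = apply (pivot-rule k R) τ (k≡ , Jτ , R≡)
    in through k R ,
       (J′ , R′≡ ,
        (λ u → from (through-⇔ k R u u) (inj₁ (reflexive u))) ,
        (λ u v e → from (through-⇔ k R u v) (inj₁ (edge u v e))) ,
        λ u v → Sum.[ sound u v , (λ (uk , kv) → sound u k uk ◅◅ sound k v kv) ] ∘ to (through-⇔ k R u v)) ,
       closes , preserves
    where
    closes : Closed k (through k R)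
    -- A connection into or out of `k` that is added via `k` was there before.
    closes u v uk kv = from (through-⇔ k R u v) (inj₂
      (Sum.[ id , proj₁ ] (to (through-⇔ k R u k) uk) , Sum.[ id , proj₂ ] (to (through-⇔ k R k v) kv)))

    preserves : ∀ w → Closed w R → Closed w (through k R)
    preserves w closed u v uw wv = from (through-⇔ k R u v)
      (path (to (through-⇔ k R u w) uw) (to (through-⇔ k R w v) wv))
      where
      path : T (R u w) ⊎ (T (R u k) × T (R k w)) → T (R w v) ⊎ (T (R w k) × T (R k v)) →
        T (R u v) ⊎ (T (R u k) × T (R k v))
      -- When both halves pass through `k`, the detour over `w` is cut out; otherwise the old
      -- closedness at `w` joins the parts.
      path (inj₁ uw) (inj₁ wv) = inj₁ (closed u v uw wv)
      path (inj₁ uw) (inj₂ (wk , kv)) = inj₂ (closed u k uw wk , kv)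
      path (inj₂ (uk , kw)) (inj₁ wv) = inj₂ (uk , closed k v kw wv)
      path (inj₂ (uk , _)) (inj₂ (_ , kv)) = inj₂ (uk , kv)

  saturate : ∀ σ → J σ × Stores (σ 6) R₀ →
    let τ = run (for 12 pivot) σ in ∃[ R ] ((∀ u v → T (R u v) ⇔ Walk E u v) × J τ × Stores (τ 6) R)
  saturate σ (Jσ , R₀≡) =
    let R , (Jτ , R≡ , reflexive , edge , sound) , closed =
          forall-rule I (λ k R _ → Closed k R) 12 pivot refl
            (λ { (Jτ , inv) → fr₁₂ Jτ , inv }) id extend (bound Jσ)
            (Jσ , R₀≡ , (λ u → from T-∨ (inj₁ (from (T-does (u ≟ u)) refl))) ,
             (λ u v e → from T-∨ (inj₂ e)) , R₀-sound)
    in R , (λ u v → mk⇔ (sound u v) (complete reflexive edge closed)) , Jτ , R≡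

search : Expr → Loop
search e = 16 [ lit 0 , lit 0 ]≔ lit 0 ⊳
  for 10 (for 11 (16 [ lit 0 , lit 0 ]≔ (cell 16 or e)))

-- The ghost value is the Boolean in the flag. The invariant keeps a witness for a set flag, while
-- the property collected over all pairs shows that a clear flag has missed none.
search-rule : ∀ {J : Store → Set} {F : PairSet n} e →
  Frame J 10 → Frame J 11 → Frame J 16 → (∀ {σ} → J σ → σ 0 0 0 ≡ n) →
  (∀ {σ u v} → J σ → σ 10 0 0 ≡ toℕ u → σ 11 0 0 ≡ toℕ v → Holds σ e (F u v)) →
  Triple J (search e) (λ σ → ∃[ b ] (((T b → ∃₂ λ u v → T (F u v)) × (∀ u v → T (F u v) → T b)) ×
                                     J σ × σ 16 0 0 ≡ bit b))
search-rule {n} {J} {F} e fr₁₀ fr₁₁ fr₁₆ bound eval-e = triple λ σ Jσ →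
  let b , (J′ , flag , found) , missed = forall²-rule I (λ u v b _ → T (F u v) → T b) 10 11
        (16 [ lit 0 , lit 0 ]≔ (cell 16 or e)) refl refl
        (Prod.map₁ fr₁₀) (Prod.map₁ fr₁₁) id id (bound ∘ proj₁) body (fr₁₆ Jσ , refl , λ ())
  in b , (found , missed) , J′ , flag
  where
  I : Bool → Store → Set
  I b σ = J σ × σ 16 0 0 ≡ bit b × (T b → ∃₂ λ u v → T (F u v))

  body : ∀ u v {b σ} → σ 10 0 0 ≡ toℕ u → σ 11 0 0 ≡ toℕ v → I b σ → _
  body u v {b} i≡u j≡v (Jσ , flag , found) =
    b ∨ F u v ,
    (fr₁₆ Jσ , value (eval-or (holds {e = cell 16} flag) (eval-e Jσ i≡u j≡v)) ,
      Sum.[ found , (λ f → u , v , f) ]′ ∘ to T-∨) ,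
    (λ f → from T-∨ (inj₂ f)) , λ w z old f → from T-∨ (inj₁ (old f))

-- Admissible steps

Marks : (ℕ → ℕ → ℕ) → Subset n → Set
Marks M p = ∀ v → M (toℕ v) 0 ≡ bit (lookup p v)

Encodes : Store → Digraph n → Set
Encodes σ H = Marks (σ 4) (V H) × Stores (σ 5) (E H)

-- The candidate is built and tested in array 9 and copied to array 5 only if it passes, so a
-- refused step leaves the current minor intact. `q` then updates the vertices.
attempt : Expr → Loop → Loop
attempt e q =
  tabulate 9 e ⊳ closure ⊳
  search (3 [ cell 10 , cell 11 ] and not′ (6 [ cell 10 , cell 11 ] equals 7 [ cell 10 , cell 11 ])) ⊳
  unless (cell 16) (tabulate 5 (9 [ cell 10 , cell 11 ]) ⊳ q)

-- The double negation is the form in which the program evaluates that two bits differ.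
T-⇔ : ∀ {b c} → (T b ⇔ T c) ⇔ (¬ T (not (not (b xor c))))
T-⇔ {true} {true} = mk⇔ (λ _ ()) (λ _ → mk⇔ _ _)
T-⇔ {true} {false} = mk⇔ (λ eq _ → to eq _) (λ ¬⊤ → contradiction _ ¬⊤)
T-⇔ {false} {true} = mk⇔ (λ eq _ → from eq _) (λ ¬⊤ → contradiction _ ¬⊤)
T-⇔ {false} {false} = mk⇔ (λ _ ()) (λ _ → mk⇔ id id)

T-¬¬ : ∀ {b} → ¬ T (not b) → T b
T-¬¬ {true} _ = _
T-¬¬ {false} ¬⊤ = contradiction _ ¬⊤

lookup-minus : ∀ (p : Subset n) v w → lookup (p - v) w ≡ not (does (w ≟ v)) ∧ lookup p w
lookup-minus (_ ∷ p) zero zero = refl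
lookup-minus (_ ∷ p) zero (suc w) = cong (λ q → lookup q w) (p─⊥≡p p)
lookup-minus (_ ∷ p) (suc v) zero = refl
lookup-minus (_ ∷ p) (suc v) (suc w) = lookup-minus p v w

Marks-minus : ∀ {σ i} {p : Subset n} {v} → i ≡ toℕ v →
  Marks (σ 4) p → Marks (write σ 4 i 0 0 4) (p - v)
Marks-minus {σ = σ} {p = p} {v} refl marks w rewrite lookup-minus p v w with w ≟ v
... | yes refl = write-≡ σ 4 (toℕ v) 0 0
... | no w≢v = write-update σ 4 {j = 0} {j′ = 0} 
  (λ w≡v _ → contradiction (toℕ-injective w≡v) w≢v) (λ _ → marks w)

eval-mark : ∀ {σ a x} {p : Subset n} {v} → Marks (σ a) p → σ x 0 0 ≡ toℕ v →
  Holds σ (a [ cell x , lit 0 ]) (lookup p v)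
eval-mark {σ = σ} {a} marks x≡v = holds (trans (cong (λ i → σ a i 0) x≡v) (marks _))

-- The steps, passes and rounds of the program

edgeStep : Loop
edgeStep = unless (not′ (5 [ cell 13 , cell 14 ])) (attempt
  (5 [ cell 10 , cell 11 ] and not′ (cell 10 equals cell 13 and cell 11 equals cell 14)) done)

erase : Loop
erase = 4 [ cell 14 , lit 0 ]≔ lit 0

-- Counter 13 holds the vertex that is kept and counter 14 the one that disappears. After a
-- successful contraction the latter is unmarked, so `deleteStep` passes over it.
contractStep deleteStep vertexStep : Loop
contractStep = unless (not′ (5 [ cell 13 , cell 14 ]) or cell 13 equals cell 14) (attempt
  ((not′ (cell 10 equals cell 11) and not′ (cell 10 equals cell 14) and not′ (cell 11 equals cell 14)) and
   (5 [ cell 10 , cell 11 ] or (cell 10 equals cell 13 and 5 [ cell 14 , cell 11 ]) or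
    (cell 11 equals cell 13 and 5 [ cell 10 , cell 14 ]))) erase)
deleteStep = unless (not′ (4 [ cell 14 , lit 0 ])) (attempt
  (5 [ cell 10 , cell 11 ] and not′ (cell 10 equals cell 14) and not′ (cell 11 equals cell 14)) erase)
vertexStep = unless (1 [ cell 14 , lit 0 ]) (contractStep ⊳ deleteStep)

edgePass vertexPass round : Loop
edgePass = for 13 (for 14 edgeStep)
vertexPass = for 13 (for 14 vertexStep)
round = edgePass ⊳ vertexPass

-- The edges go to array 9 first because `closure` reads its graph there; the closure is saved in
-- array 7 for all later comparisons.
initialize program : Loop
initialize =
  for 10 (4 [ cell 10 , lit 0 ]≔ lit 1) ⊳
  tabulate 9 (2 [ cell 10 , cell 11 ]) ⊳ tabulate 5 (9 [ cell 10 , cell 11 ]) ⊳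
  closure ⊳ tabulate 7 (6 [ cell 10 , cell 11 ])
program = initialize ⊳ for 15 round

-- Correctness of the steps, passes and rounds

module _ {K : Subset n} {P : PairSet n} {G : Digraph n}
  (S : PairSet n) (S-reach : ∀ u v → T (S u v) ⇔ Reachable G u v) where

  Setting : Store → Set
  Setting σ = σ 0 0 0 ≡ n × Marks (σ 1) K × Stores (σ 3) P × Stores (σ 7) S

  At : Fin n → Fin n → Store → Set
  At u v σ = Setting σ × σ 13 0 0 ≡ toℕ u × σ 14 0 0 ≡ toℕ v

  Accepted : Digraph n → Store → Set
  Accepted H′ σ = Encodes σ H′ × Preserves K P G H′ × (∀ s t → Dec (Reachable H′ s t))

  Refused : Digraph n → Digraph n → Store → Set
  Refused H H′ σ = Encodes σ H × Distinguished K P G H′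

  -- The computed closures decide reachability in `H′` and in `G`, so a difference found on `P` is a
  -- distinguishing pair and a fruitless search proves preservation.
  attempt-rule : ∀ {u v H H′} e q →
    (∀ {σ x y} → At u v σ → Stores (σ 5) (E H) → σ 10 0 0 ≡ toℕ x → σ 11 0 0 ≡ toℕ y →
      Holds σ e (E H′ x y)) →
    Triple (λ σ → At u v σ × Marks (σ 4) (V H) × Stores (σ 5) (E H′)) q
      (λ σ → At u v σ × Encodes σ H′) →
    Triple (λ σ → At u v σ × Encodes σ H) (attempt e q)
      (λ σ → At u v σ × (Accepted H′ σ ⊎ Refused H H′ σ))
  attempt-rule {u} {v} {H} {H′} e q eval-e run-q =
    seq-rule (tabulate-rule {F = E H′} 9 e refl refl id id id (proj₁ ∘ proj₁ ∘ proj₁)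
      λ (at , _ , edges) → eval-e at edges)
    (seq-rule (closure-rule {E = E H′} (id ∷ id ∷ id ∷ id ∷ id ∷ []) (proj₁ ∘ proj₁ ∘ proj₁ ∘ proj₁) proj₂)
    (∃-rule λ R → triple λ σ (R-reach , inv) → apply (decide R R-reach) σ inv))
    where
    module _ (R : PairSet n) (R-reach : ∀ s t → T (R s t) ⇔ Reachable H′ s t) where

      differ : PairSet n
      differ s t = P s t ∧ not (not (R s t xor S s t))

      distinguished : (∃₂ λ s t → T (differ s t)) → Distinguished K P G H′
      distinguished (s , t , f) = let Pst , ≢ = to T-∧ f in s , t , Pst , λ iff →
        to (T-⇔ {R s t} {S s t}) (⇔-trans (R-reach s t) (⇔-trans iff (⇔-sym (S-reach s t)))) ≢

      preserves : (∀ s t → ¬ T (differ s t)) → Preserves K P G H′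
      preserves same s t Pst = ⇔-trans (⇔-sym (R-reach s t))
        (⇔-trans (from (T-⇔ {R s t} {S s t}) λ ≢ → same s t (from T-∧ (Pst , ≢))) (S-reach s t))

      reach? : ∀ s t → Dec (Reachable H′ s t)
      reach? s t = Dec.map (R-reach s t) (T? (R s t))

      decide : Triple (λ σ → ((At u v σ × Encodes σ H) × Stores (σ 9) (E H′)) × Stores (σ 6) R)
        (search (3 [ cell 10 , cell 11 ] and not′ (6 [ cell 10 , cell 11 ] equals 7 [ cell 10 , cell 11 ])) ⊳
         unless (cell 16) (tabulate 5 (9 [ cell 10 , cell 11 ]) ⊳ q))
        (λ σ → At u v σ × (Accepted H′ σ ⊎ Refused H H′ σ))
      decide = seq-rule
        (search-rule {F = differ} _ id id id (proj₁ ∘ proj₁ ∘ proj₁ ∘ proj₁ ∘ proj₁)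
          λ ((((((_ , _ , P≡ , S≡) , _) , _) , _) , R≡)) i≡s j≡t →
            eval-and (eval-cell P≡ i≡s j≡t)
              (eval-not (eval-equals (eval-cell R≡ i≡s j≡t) (eval-cell S≡ i≡s j≡t))))
        (∃-rule λ b → unless-rule {b = b} (λ (_ , _ , flag) → holds flag)
          (λ Tb ((found , _) , (((at , enc) , _) , _) , _) → at , inj₂ (enc , distinguished (found Tb)))
          λ ¬b → triple λ σ ((_ , missed) , (((at , marks , _) , cand) , _) , _) →
            let at′ , enc′ = apply install σ (at , marks , cand)
            in at′ , inj₁ (enc′ , preserves (λ s t → ¬b ∘ missed s t) , reach?))
        where
        install : Triple (λ σ → At u v σ × Marks (σ 4) (V H) × Stores (σ 9) (E H′))
          (tabulate 5 (9 [ cell 10 , cell 11 ]) ⊳ q) (λ σ → At u v σ × Encodes σ H′)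
        install = seq-rule
          (tabulate-rule {F = E H′} 5 _ refl refl id id id (proj₁ ∘ proj₁ ∘ proj₁)
            λ (_ , _ , cand) → eval-cell cand)
          (weaken-pre (λ ((at , marks , _) , edges) → at , marks , edges) run-q)

  step-rule : ∀ {u v H H′} e q → MinorStep K H H′ → K ⊆ V H′ → Admissible K P G H →
    (∀ {σ x y} → At u v σ → Stores (σ 5) (E H) → σ 10 0 0 ≡ toℕ x → σ 11 0 0 ≡ toℕ y →
      Holds σ e (E H′ x y)) →
    Triple (λ σ → At u v σ × Marks (σ 4) (V H) × Stores (σ 5) (E H′)) q
      (λ σ → At u v σ × Encodes σ H′) →
    Triple (λ σ → At u v σ × Encodes σ H) (attempt e q)
      (λ σ → (At u v σ × Encodes σ H′ × Admissible K P G H′) ⊎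
             (At u v σ × Encodes σ H × Distinguished K P G H′))
  step-rule {H = H} {H′} e q step K⊆ adm eval-e run-q = weaken-post
    (λ where
      (at , inj₁ (enc , preserves , reach?)) → inj₁ (at , enc , record
        { isMinor = Admissible.isMinor adm ◅◅ step ◅ ε ; terminals = K⊆
        ; preserves = preserves ; reach? = reach? })
      (at , inj₂ (enc , distinguished)) → inj₂ (at , enc , distinguished))
    (attempt-rule {H = H} {H′} e q eval-e run-q)

  EdgeProgress : Fin n → Fin n → Digraph n → Digraph n → Set
  EdgeProgress u v H H′ = Admissible K P G H′ × order K H′ ≡ order K H ×
    EdgeMinimal K P G H′ u v × (∀ w z → EdgeMinimal K P G H w z → EdgeMinimal K P G H′ w z)

  edgeStep-rule : ∀ u v H → Admissible K P G H →
    Triple (λ σ → At u v σ × Encodes σ H) edgeStep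
      (λ σ → ∃[ H′ ] (At u v σ × Encodes σ H′ × EdgeProgress u v H H′))
  edgeStep-rule u v H adm = unless-rule {b = not (E H u v)}
    (λ ((_ , u≡ , v≡) , _ , edges) → eval-not (eval-cell edges u≡ v≡))
    (λ ¬e (at , enc) → H , at , enc , adm , refl ,
      (λ e → contradiction e (to (T-does (¬? (T? (E H u v)))) ¬e)) , λ _ _ → id)
    λ ¬¬e → weaken-post
      (λ where
        (inj₁ (at , enc , adm′)) → H′ , at , enc , adm′ , refl ,
          (λ e → contradiction (refl , refl) (proj₂ (to (withoutEdge-⇔ (E H) u v u v) e))) , still-minimal
        (inj₂ (at , enc , distinguished)) → H , at , enc , adm , refl , (λ _ → distinguished) , λ _ _ → id)
      (step-rule {H = H} {H′} _ done (deleteEdge u v (T-¬¬ ¬¬e) refl (withoutEdge-⇔ (E H) u v))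
        (Admissible.terminals adm) adm
        (λ (_ , u≡ , v≡) edges i≡x j≡y → eval-and (eval-cell edges i≡x j≡y)
          (eval-not (eval-and (eval-≟ i≡x u≡) (eval-≟ j≡y v≡))))
        (triple λ _ → id))
    where
    H′ = dropEdge H u v

    -- `H` without `(w , z)` contains `H′` without it, so a pair lost in the former cannot be
    -- preserved in the latter.
    still-minimal : ∀ w z → EdgeMinimal K P G H w z → EdgeMinimal K P G H′ w z
    still-minimal w z minimal wz =
      let s , t , Pst , ≁ = minimal (proj₁ (to (withoutEdge-⇔ (E H) u v w z) wz))
      in s , t , Pst , λ iff → ≁ (mk⇔
           (to (Admissible.preserves adm s t Pst) ∘
              Star.map (λ {x} {y} → proj₁ ∘ to (withoutEdge-⇔ (E H) w z x y)))
           (Star.map (λ {x} {y} xy → let xy , ≢wz = to (withoutEdge-⇔ (E H′) w z x y) xy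
                                     in from (withoutEdge-⇔ (E H) w z x y)
                                          (proj₁ (to (withoutEdge-⇔ (E H) u v x y) xy) , ≢wz))
             ∘ from iff))

  -- A step either lowers the order or leaves the very same graph, about which it then has learnt
  -- `X`.
  Progress : Digraph n → Set → Digraph n → Set
  Progress H X H′ = Admissible K P G H′ ×
    (order K H′ < order K H ⊎ (H′ ≡ H × X))

  Improves : Fin n → Fin n → Loop → (Digraph n → Set) → Set
  Improves u v p X = ∀ H → Admissible K P G H →
    Triple (λ σ → At u v σ × Encodes σ H) p
      (λ σ → ∃[ H′ ] (At u v σ × Encodes σ H′ × Progress H (X H) H′))

  erase-rule : ∀ {u v H′ p} → V H′ ≡ p - v →
    Triple (λ σ → At u v σ × Marks (σ 4) p × Stores (σ 5) (E H′)) erase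
      (λ σ → At u v σ × Encodes σ H′)
  erase-rule {p = p} eq = triple λ σ ((s , u≡ , v≡) , marks , edges) →
    (s , u≡ , v≡) ,
    subst (Marks (write σ 4 (σ 14 0 0) 0 0 4)) (sym eq) (Marks-minus {σ = σ} {p = p} v≡ marks) , edges

  progress-after : ∀ {H H₁ H₂ X Y} → order K H₁ < order K H → Progress H₁ X H₂ → Progress H Y H₂
  progress-after lt (adm , inj₁ lt′) = adm , inj₁ (ℕ.<-trans lt′ lt)
  progress-after lt (adm , inj₂ (refl , _)) = adm , inj₁ lt

  improves-seq : ∀ {u v p q X Y} → Improves u v p X → Improves u v q Y →
    Improves u v (p ⊳ q) (λ H → X H × Y H)
  improves-seq {u} {v} {q = q} {X} {Y} P Q H adm = seq-rule (P H adm) (∃-rule next)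
    where
    next : ∀ H₁ → Triple (λ σ → At u v σ × Encodes σ H₁ × Progress H (X H) H₁) q
      (λ σ → ∃[ H₂ ] (At u v σ × Encodes σ H₂ × Progress H (X H × Y H) H₂))
    next H₁ = triple λ where
      σ (at , enc , adm₁ , inj₁ lt₁) →
        Prod.map₂ (Prod.map₂ (Prod.map₂ (progress-after lt₁))) (apply (Q H₁ adm₁) σ (at , enc))
      -- The first part changed nothing, so the second one runs on `H` itself and both findings
      -- concern the same graph.
      σ (at , enc , _ , inj₂ (refl , X₁)) →
        Prod.map₂ (Prod.map₂ (Prod.map₂ (Prod.map₂ (Sum.map₂ (Prod.map₂ (X₁ ,_))))))
          (apply (Q H adm) σ (at , enc))

  module _ {u v : Fin n} (v∉K : v ∉ K) where

    K⊆minus : ∀ {H} → Admissible K P G H → K ⊆ V H - v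
    K⊆minus adm x∈K = x∈p∧x≢y⇒x∈p-y (Admissible.terminals adm x∈K) λ { refl → v∉K x∈K }

    contractStep-rule : Improves u v contractStep
      (λ H → (e : T (E H u v)) → u ≢ v → Distinguished K P G (contract H u v e))
    contractStep-rule H adm = unless-rule {b = not (E H u v) ∨ does (u ≟ v)}
      (λ ((_ , u≡ , v≡) , _ , edges) → eval-or (eval-not (eval-cell edges u≡ v≡)) (eval-≟ u≡ v≡))
      (λ b (at , enc) → H , at , enc , adm , inj₂ (refl , λ e u≢v → contradiction (to T-∨ b)
        Sum.[ (λ ¬e → to (T-does (¬? (T? (E H u v)))) ¬e e) , (λ u≡v → u≢v (to (T-does (u ≟ v)) u≡v)) ]))
      (λ ¬b → try (T-¬¬ (λ ¬e → ¬b (from T-∨ (inj₁ ¬e))))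
                  (λ u≡v → ¬b (from T-∨ (inj₂ (from (T-does (u ≟ v)) u≡v)))))
      where
      try : T (E H u v) → u ≢ v → Triple _ _ _
      try e u≢v = weaken-post
        (λ where
          (inj₁ (at , enc , adm′)) → contract H u v e , at , enc , adm′ ,
            inj₁ (order-drop K H (proj₂ (E⊆V H u v e)) v∉K)
          (inj₂ (at , enc , distinguished)) → H , at , enc , adm , inj₂ (refl , λ _ _ → distinguished))
        (step-rule {H = H} {contract H u v e} _ erase
          (contractEdge u v (inj₁ e) u≢v v∉K refl (contraction-⇔ (E H) u≢v)) (K⊆minus adm) adm
          (λ (_ , u≡ , v≡) edges i≡x j≡y → eval-and
            (eval-and (eval-not (eval-≟ i≡x j≡y))
                      (eval-and (eval-not (eval-≟ i≡x v≡)) (eval-not (eval-≟ j≡y v≡))))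
            (eval-or (eval-cell edges i≡x j≡y)
              (eval-or (eval-and (eval-≟ i≡x u≡) (eval-cell edges v≡ j≡y))
                       (eval-and (eval-≟ j≡y u≡) (eval-cell edges i≡x v≡)))))
          (erase-rule {H′ = contract H u v e} {V H} refl))

    deleteStep-rule : Improves u v deleteStep (λ H → v ∈ V H → Distinguished K P G (dropVertex H v))
    deleteStep-rule H adm = unless-rule {b = not (lookup (V H) v)}
      (λ ((_ , u≡ , v≡) , marks , _) → eval-not (eval-mark {p = V H} marks v≡))
      (λ ¬v (at , enc) → H , at , enc , adm , inj₂ (refl , λ v∈V →
        contradiction (from T-≡ ([]=⇒lookup v∈V)) (to (T-does (¬? (T? (lookup (V H) v)))) ¬v)))
      (λ ¬¬v → try (lookup⇒[]= v (V H) (to T-≡ (T-¬¬ ¬¬v))))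
      where
      try : v ∈ V H → Triple _ _ _
      try v∈V = weaken-post
        (λ where
          (inj₁ (at , enc , adm′)) → dropVertex H v , at , enc , adm′ , inj₁ (order-drop K H v∈V v∉K)
          (inj₂ (at , enc , distinguished)) → H , at , enc , adm , inj₂ (refl , λ _ → distinguished))
        (step-rule {H = H} {dropVertex H v} _ erase
          (deleteVertex v v∈V v∉K refl (withoutVertex-⇔ (E H) v)) (K⊆minus adm) adm
          (λ (_ , u≡ , v≡) edges i≡x j≡y → eval-and (eval-cell edges i≡x j≡y)
            (eval-and (eval-not (eval-≟ i≡x v≡)) (eval-not (eval-≟ j≡y v≡))))
          (erase-rule {H′ = dropVertex H v} {V H} refl))

  vertexStep-rule : ∀ u v → Improves u v vertexStep (λ H → VertexMinimal K P G H u v)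
  vertexStep-rule u v H adm = unless-rule {b = lookup K v}
    (λ ((( _ , terminals , _) , u≡ , v≡) , _) → eval-mark {p = K} terminals v≡)
    (λ v∈K (at , enc) → H , at , enc , adm , inj₂ (refl , λ v∉K →
      contradiction (lookup⇒[]= v K (to T-≡ v∈K)) v∉K))
    λ ¬v∈K → weaken-post (λ (H′ , at , enc , adm′ , progress) → H′ , at , enc , adm′ ,
        Sum.map₂ (Prod.map₂ (λ minimal _ → minimal)) progress)
      (improves-seq (contractStep-rule (λ v∈K → ¬v∈K (from T-≡ ([]=⇒lookup v∈K))))
        (deleteStep-rule {u} (λ v∈K → ¬v∈K (from T-≡ ([]=⇒lookup v∈K)))) H adm)

  -- Unavoidable edges stay unavoidable under later deletions, so a single pass suffices. The order
  -- is recorded because the round has to compare it with the order after the vertex pass.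
  edgePass-rule : ∀ m →
    Triple (λ σ → ∃[ H ] (Setting σ × Encodes σ H × Admissible K P G H × order K H ≡ m)) edgePass
      (λ σ → ∃[ H ] ((Setting σ × Encodes σ H × Admissible K P G H × order K H ≡ m) ×
                     ∀ u v → EdgeMinimal K P G H u v))
  edgePass-rule m = ∃-rule λ H → triple λ σ inv →
    forall²-rule I (λ u v H _ → EdgeMinimal K P G H u v) 13 14 edgeStep refl refl
      id id id id (proj₁ ∘ proj₁) body {H} {σ} inv
    where
    I : Digraph n → Store → Set
    I H σ = Setting σ × Encodes σ H × Admissible K P G H × order K H ≡ m

    body : ∀ u v {H σ} → σ 13 0 0 ≡ toℕ u → σ 14 0 0 ≡ toℕ v → I H σ →
      ∃[ H′ ] (I H′ (run edgeStep σ) × EdgeMinimal K P G H′ u v ×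
               ∀ w z → EdgeMinimal K P G H w z → EdgeMinimal K P G H′ w z)
    body u v {H} {σ} u≡ v≡ (setting , enc , adm , order≡) =
      let H′ , (setting′ , _) , enc′ , adm′ , order≡′ , minimal , keep =
            apply (edgeStep-rule u v H adm) σ ((setting , u≡ , v≡) , enc)
      in H′ , (setting′ , enc′ , adm′ , trans order≡′ order≡) , minimal , keep

  -- Findings are claimed for the initial graph `H₀` only. Once the order has dropped nothing more
  -- is claimed; if it never drops, every test was made on `H₀`.
  vertexPass-rule : ∀ H₀ → Admissible K P G H₀ →
    Triple (λ σ → Setting σ × Encodes σ H₀) vertexPass
      (λ σ → ∃[ H ] (Setting σ × Encodes σ H × Progress H₀ (∀ u v → VertexMinimal K P G H₀ u v) H))
  vertexPass-rule H₀ adm₀ = triple λ σ (setting , enc) →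
    let H , (setting′ , enc′ , adm , status) , minimal =
          forall²-rule I (λ u v H _ → Φ u v H) 13 14 vertexStep refl refl id id id id (proj₁ ∘ proj₁) body
            {H₀} {σ} (setting , enc , adm₀ , inj₂ refl)
    in H , setting′ , enc′ , adm , conclude status minimal
    where
    Smaller : Digraph n → Set
    Smaller H = order K H < order K H₀

    I : Digraph n → Store → Set
    I H σ = Setting σ × Encodes σ H × Admissible K P G H × (Smaller H ⊎ H ≡ H₀)

    Φ : Fin n → Fin n → Digraph n → Set
    Φ u v H = Smaller H ⊎ VertexMinimal K P G H₀ u v

    advance : ∀ {u v H H′} → Smaller H ⊎ H ≡ H₀ → Progress H (VertexMinimal K P G H u v) H′ →
      (Smaller H′ ⊎ H′ ≡ H₀) × Φ u v H′ × (∀ w z → Φ w z H → Φ w z H′)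
    advance (inj₁ lt₀) (_ , inj₁ lt) =
      let lt₀′ = ℕ.<-trans lt lt₀ in inj₁ lt₀′ , inj₁ lt₀′ , λ _ _ _ → inj₁ lt₀′
    advance (inj₂ refl) (_ , inj₁ lt) = inj₁ lt , inj₁ lt , λ _ _ _ → inj₁ lt
    advance (inj₁ lt₀) (_ , inj₂ (refl , _)) = inj₁ lt₀ , inj₁ lt₀ , λ _ _ → id
    advance (inj₂ refl) (_ , inj₂ (refl , minimal)) = inj₂ refl , inj₂ minimal , λ _ _ → id

    body : ∀ u v {H σ} → σ 13 0 0 ≡ toℕ u → σ 14 0 0 ≡ toℕ v → I H σ →
      ∃[ H′ ] (I H′ (run vertexStep σ) × Φ u v H′ × (∀ w z → Φ w z H → Φ w z H′))
    body u v {H} {σ} u≡ v≡ (setting , enc , adm , status) =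
      let H′ , (setting′ , _) , enc′ , progress =
            apply (vertexStep-rule u v H adm) σ ((setting , u≡ , v≡) , enc)
          status′ , minimal , keep = advance status progress
      in H′ , (setting′ , enc′ , proj₁ progress , status′) , minimal , keep

    conclude : ∀ {H} → Smaller H ⊎ H ≡ H₀ → (∀ u v → Φ u v H) →
      Smaller H ⊎ (H ≡ H₀ × ∀ u v → VertexMinimal K P G H₀ u v)
    conclude (inj₁ lt₀) _ = inj₁ lt₀
    conclude (inj₂ refl) minimal =
      inj₂ (refl , λ u v → Sum.[ (λ lt₀ → contradiction lt₀ (ℕ.n≮n _)) , id ] (minimal u v))

  module _ (P⊆K : PairsOf K P) where

    -- After `r` rounds either the desired bound holds or each round has removed a nonterminal, of
    -- which there were at most `n`.
    Bounded : ℕ → Digraph n → Set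
    Bounded r H = order K H ≤ size P ^ 2 ⊎ order K H + r ≤ n

    round-rule : ∀ r H → Admissible K P G H → Bounded r H →
      Triple (λ σ → Setting σ × Encodes σ H) round
        (λ σ → ∃[ H′ ] (Setting σ × Encodes σ H′ × Admissible K P G H′ × Bounded (suc r) H′))
    round-rule r H adm bounded = seq-rule
      (weaken-pre (λ (setting , enc) → H , setting , enc , adm , refl) (edgePass-rule (order K H)))
      (∃-rule λ H₁ → triple λ σ ((setting , enc , adm₁ , order≡) , edgeMinimal) →
        let H₂ , setting′ , enc′ , adm₂ , status = apply (vertexPass-rule H₁ adm₁) σ (setting , enc)
        in H₂ , setting′ , enc′ , adm₂ , bound adm₁ edgeMinimal 
             (subst (λ m → m ≤ size P ^ 2 ⊎ m + r ≤ n) (sym order≡) bounded) status)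
      where
      bound : ∀ {H₁ H₂} → Admissible K P G H₁ → (∀ u v → EdgeMinimal K P G H₁ u v) → Bounded r H₁ →
        order K H₂ < order K H₁ ⊎ (H₂ ≡ H₁ × ∀ u v → VertexMinimal K P G H₁ u v) → Bounded (suc r) H₂
      -- The vertex pass changed nothing, so edge and vertex minimality hold for the same graph.
      bound adm₁ edgeMinimal _ (inj₂ (refl , vertexMinimal)) =
        inj₁ (Critical.order-bound K P G P⊆K adm₁ edgeMinimal vertexMinimal)
      bound _ _ (inj₁ small) (inj₁ lt) = inj₁ (ℕ.≤-trans (ℕ.<⇒≤ lt) small)
      bound _ _ (inj₂ ≤n) (inj₁ lt) =
        inj₂ (ℕ.≤-trans (ℕ.≤-reflexive (ℕ.+-suc _ r)) (ℕ.≤-trans (ℕ.+-monoˡ-≤ r lt) ≤n))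

    rounds-rule : ∀ H → Admissible K P G H → order K H ≤ n →
      Triple (λ σ → Setting σ × Encodes σ H) (for 15 round)
        (λ σ → ∃[ H′ ] (Encodes σ H′ × Admissible K P G H′ × order K H′ ≤ size P ^ 2))
    rounds-rule H adm ≤n = triple λ σ (setting , enc) →
      let H′ , _ , enc′ , adm′ , bounded =
            for-rule I 15 round refl id step {H} {σ} (proj₁ setting)
              (setting , enc , adm , inj₂ (subst (_≤ n) (sym (ℕ.+-identityʳ _)) ≤n))
      -- After `n` rounds the second alternative leaves no nonterminal at all.
      in H′ , enc′ , adm′ , Sum.[ id , (λ ≤n → ℕ.≤-trans (ℕ.+-cancelʳ-≤ n _ 0 ≤n) z≤n) ]′ bounded
      where
      I : ℕ → Digraph n → Store → Set
      I r H σ = Setting σ × Encodes σ H × Admissible K P G H × Bounded r H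

      step : ∀ (r : Fin n) {H σ} → σ 15 0 0 ≡ toℕ r → I (toℕ r) H σ →
        ∃[ H′ ] I (suc (toℕ r)) H′ (run round σ)
      step r {H} {σ} _ (setting , enc , adm , bounded) =
        apply (round-rule (toℕ r) H adm bounded) σ (setting , enc)

-- The algorithm

module _ {k} (G : TerminalDigraph n k) (P : PairSet n) where

  Given : Store → Set
  Given σ = σ 0 0 0 ≡ n × Marks (σ 1) (K G) × Stores (σ 2) (E (graph G)) × Stores (σ 3) P

  Reach : PairSet n → Set
  Reach S = ∀ u v → T (S u v) ⇔ Reachable (graph G) u v

  Ready : (∃[ S ] Reach S) → Store → Set
  Ready (S , S-reach) σ = Setting {K = K G} {P} {graph G} S S-reach σ × Encodes σ (graph G)

  mark-rule : Triple Given (for 10 (4 [ cell 10 , lit 0 ]≔ lit 1)) (λ σ → Given σ × Marks (σ 4) ⊤)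
  mark-rule = triple λ σ given → proj₂ (forall-rule (λ _ → Given)
    (λ v _ σ → σ 4 (toℕ v) 0 ≡ bit (lookup ⊤ v))
    10 (4 [ cell 10 , lit 0 ]≔ lit 1) refl id id
    (λ v {_} {σ} i≡v given → tt , given ,
      write-update σ 4 {j = 0} {j′ = 0} (λ _ _ → marked v) (λ ≢ → contradiction (sym i≡v , refl) ≢) ,
      λ w old → write-update σ 4 {j = 0} {j′ = 0} (λ _ _ → marked w) (λ _ → old))
    {tt} {σ} (proj₁ given) given)
    where
    marked : ∀ v → 1 ≡ bit (lookup ⊤ v)
    marked v = cong bit (sym ([]=⇒lookup (∈⊤ {x = v})))

  initialize-rule : Triple Given initialize (λ σ → ∃[ S ] Ready S σ)
  initialize-rule =
    seq-rule mark-rule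
    (seq-rule (tabulate-rule {F = E (graph G)} 9 _ refl refl id id id (proj₁ ∘ proj₁)
      λ ((_ , _ , edges , _) , _) i≡x j≡y → eval-cell edges i≡x j≡y)
    (seq-rule (tabulate-rule {F = E (graph G)} 5 _ refl refl id id id (proj₁ ∘ proj₁ ∘ proj₁)
      λ (_ , edges) i≡x j≡y → eval-cell edges i≡x j≡y)
    (seq-rule (closure-rule {E = E (graph G)} (id ∷ id ∷ id ∷ id ∷ id ∷ []) (proj₁ ∘ proj₁ ∘ proj₁ ∘ proj₁)
      (λ ((_ , edges) , _) → edges))
    (∃-rule λ S → weaken-post
      (λ {σ} ((S-reach , ((((n≡ , terminals , _ , pairs) , marks) , _) , edges) , _) , closed) →
        (S , S-reach) , (n≡ , terminals , pairs , closed) , subst (Marks (σ 4)) (sym (V≡⊤ G)) marks , edges)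
      (tabulate-rule {F = S} 7 _ refl refl id id id (proj₁ ∘ proj₁ ∘ proj₁ ∘ proj₁ ∘ proj₁ ∘ proj₂)
        λ (_ , _ , closed) i≡x j≡y → eval-cell closed i≡x j≡y)))))

  program-rule : PairsOf (K G) P → Triple Given program
    (λ σ → ∃[ H ] (Encodes σ H × Admissible (K G) P (graph G) H × order (K G) H ≤ size P ^ 2))
  program-rule P⊆K = seq-rule initialize-rule (∃-rule λ (S , S-reach) →
    rounds-rule S S-reach P⊆K (graph G) (initial S S-reach) (∣p∣≤n (V (graph G) ─ K G)))
    where
    initial : ∀ S → Reach S → Admissible (K G) P (graph G) (graph G)
    initial S S-reach = record
      { isMinor = ε
      ; terminals = λ _ → subst (_ ∈_) (sym (V≡⊤ G)) ∈⊤
      ; preserves = λ _ _ _ → mk⇔ id id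
      ; reach? = λ s t → Dec.map (S-reach s t) (T? (S s t)) }

-- The input encoding and the time bound

pad-toℕ : ∀ (f : Fin n → ℕ) v → pad f (toℕ v) ≡ f v
pad-toℕ {n} f v with toℕ v <? n
... | yes v<n = cong f (fromℕ<-toℕ v v<n)
... | no v≮n = contradiction (toℕ<n v) v≮n

matrix-Stores : ∀ (R : PairSet n) → Stores (matrix R) R
matrix-Stores R u v =
  trans (pad-toℕ (λ u → pad (λ v → bit (R u v)) (toℕ v)) u) (pad-toℕ (λ v → bit (R u v)) v)

input-Given : ∀ {k} (G : TerminalDigraph n k) P → Given G P (input G P)
input-Given G P = refl , pad-toℕ _ , matrix-Stores _ , matrix-Stores _

Sparse : ℕ → ∀ {n k} → TerminalDigraph n k → PairSet n → Digraph n → Set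
Sparse C G P H = ReachabilityPreservingMinor G P H × nonterminals G H ≤ C * size P ^ 2

solvesInTime : ∀ p → T (wellFormed p) →
  (∀ {n k} (G : TerminalDigraph n k) P → PairsOf (K G) P → Triple (Given G P) p
    (λ σ → ∃[ H ] (Encodes σ H × Admissible (K G) P (graph G) H × order (K G) H ≤ size P ^ 2))) →
  ∃[ c ] ∃[ d ] SolvesInTime (compile p) (λ n → c * n ^ d + c) (Sparse 1)
solvesInTime p wf rule =
  let c , d , cost≤ = polynomial-bound (cost-polynomial p)
  in c , d , λ {n} G P P⊆K →
    let t , halts , t≤ = compile-correct p wf {n} {input G P} refl
        H , (vertices , edges) , adm , small = apply (rule G P P⊆K) (input G P) (input-Given G P)
    in t , run p (input G P) , H , halts , ℕ.≤-trans t≤ (cost≤ n) ,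
       record { vertices = vertices ; edges = edges } ,
       record { isMinor = Admissible.isMinor adm
              ; terminals = Admissible.terminals adm
              ; preserves = Admissible.preserves adm } ,
       ℕ.≤-trans small (ℕ.≤-reflexive (sym (ℕ.*-identityˡ _)))

mainTheorem6 : ∃[ p ] ∃[ c ] ∃[ d ] ∃[ C ]
    SolvesInTime p (λ n → c * n ^ d + c)
    (λ G P H → ReachabilityPreservingMinor G P H × nonterminals G H ≤ C * size P ^ 2)
mainTheorem6 =
  -- `tt` is enough since `wellFormed program` evaluates to `true`. The number of nonterminals is at
  -- most the square itself, so the constant is 1.
  let c , d , solves = solvesInTime program tt program-rule
  in compile program , c , d , 1 , solves
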